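{- For every integer $m \ge 2$ the following upper bounds hold: $d(m,2m+3)\le 17$, $d(m,2m+4)\le 21$, $d(m,2m+5)\le 158$, $d(m,2m+6)\le 158$, $d(m,2m+7)\le 252$, $d(m,2m+8)\le 297$, $d(m,2m+9)\le 1073$, $d(m,2m+10)\le 1273$, $d(m,2m+11)\le 1888$, $d(m,2m+12)\le 2189$, $d(m,2m+13)\le 3224$, $d(m,2m+14)\le 3696$, $d(m,2m+15)\le 5141$, $d(m,2m+16)\le 6586$, $d(m,2m+17)\le 11692$, $d(m,2m+18)\le 12296$, $d(m,2m+19)\le 16027$, $d(m,2m+20)\le 19758$, $d(m,2m+21)\le 32054$, $d(m,2m+22)\le 39516$, $d(m,2m+23)\le 254364$, $d(m,2m+24)\le 276612$, $d(m,2m+25)\le 338169$, $d(m,2m+26)\le 399726$, $d(m,2m+27)\le 1614202$, $d(m,2m+28)\le 1725442$, $d(m,2m+29)\le 2033227$, $d(m,2m+30)\le 2067824$, $d(m,2m+31)\le 8132908$, $d(m,2m+32)\le 8271296$, $d(m,2m+33)\le 26431951$, $d(m,2m+34)\le 26881712$, $d(m,2m+35)\le 105727804$, $d(m,2m+36)\le 107526848$.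
   Context: An integral point set in $\mathbb{R}^m$ is a finite set $\mathcal{P}$ of points of the $m$-dimensional Euclidean space $\mathbb{R}^m$ such that the Euclidean distance between any two points of $\mathcal{P}$ is an integer and $\mathcal{P}$ is not contained in an $(m-1)$-dimensional (affine) hyperplane. Its diameter is $\operatorname{diam}(\mathcal{P}) = \max_{P_1, P_2 \in \mathcal{P}} |P_1P_2|$. The function $d(m,n)$ is the minimal possible diameter of an integral point set of $n$ points in $\mathbb{R}^m$. -}

module Defs where

open import Data.Fin using (Fin)
open import Data.Integer using (+_)
open import Data.List using (allFin; cartesianProductWith)
open import Data.List.Extrema.Nat using (max)
open import Data.Nat as ℕ using (ℕ)
import Data.Nat.Properties as ℕP
open import Data.Product using (Σ; ∃; _×_; _,_; proj₁; proj₂)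
open import Data.Rational as ℚ using (ℚ; 0ℚ; 1ℚ; ½; ∣_∣; 1/_)
import Data.Rational.Properties as ℚP
open import Data.Rational.Solver using (module +-*-Solver)
open import Data.Vec.Functional using (Vector; foldr)
open import Function.Definitions using (Injective)
open import Relation.Binary.PropositionalEquality
open import Relation.Nullary using (¬_)

------------------------------------------------------------------------
-- The real numbers, as Cauchy sequences of rationals up to _≃_

IsCauchy : (ℕ → ℚ) → Set
IsCauchy x = ∀ ε → 0ℚ ℚ.< ε →
  ∃ λ N → ∀ i j → N ℕ.≤ i → N ℕ.≤ j → ∣ x i ℚ.- x j ∣ ℚ.≤ ε

record ℝ : Set where
  constructor mkℝ
  field
    seq    : ℕ → ℚ
    cauchy : IsCauchy seq

open ℝ public

infix 4 _≃_ _≤ᴿ_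

_≃_ : ℝ → ℝ → Set
x ≃ y = ∀ ε → 0ℚ ℚ.< ε →
  ∃ λ N → ∀ i → N ℕ.≤ i → ∣ seq x i ℚ.- seq y i ∣ ℚ.≤ ε

_≤ᴿ_ : ℝ → ℝ → Set
x ≤ᴿ y = ∀ ε → 0ℚ ℚ.< ε →
  ∃ λ N → ∀ i → N ℕ.≤ i → seq x i ℚ.≤ seq y i ℚ.+ ε

fromℚ : ℚ → ℝ
fromℚ q = mkℝ (λ _ → q) λ ε 0<ε → 0 , λ _ _ _ _ →
  subst (ℚ._≤ ε) (sym (cong ∣_∣ (ℚP.+-inverseʳ q))) (ℚP.<⇒≤ 0<ε)

fromℕ : ℕ → ℝ
fromℕ n = fromℚ (+ n ℚ./ 1)

0ᴿ : ℝ
0ᴿ = fromℚ 0ℚ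

private
  half-pos : ∀ {ε} → 0ℚ ℚ.< ε → 0ℚ ℚ.< ½ ℚ.* ε
  half-pos {ε} 0<ε = subst (ℚ._< ½ ℚ.* ε) (ℚP.*-zeroʳ ½) (ℚP.*-monoʳ-<-pos ½ 0<ε)

  halves : ∀ ε → ½ ℚ.* ε ℚ.+ ½ ℚ.* ε ≡ ε
  halves ε = trans (sym (ℚP.*-distribʳ-+ ε ½ ½)) (ℚP.*-identityˡ ε)

  open +-*-Solver using (solve; _:=_; _:+_; _:*_; :-_)

  abstract
    +-cauchy : ∀ {x y} → IsCauchy x → IsCauchy y → IsCauchy (λ i → x i ℚ.+ y i)
    +-cauchy {x} {y} cx cy ε 0<ε =
      let N₁ , p = cx (½ ℚ.* ε) (half-pos 0<ε)
          N₂ , q = cy (½ ℚ.* ε) (half-pos 0<ε)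
      in N₁ ℕ.⊔ N₂ , λ i j N≤i N≤j → begin
        ∣ (x i ℚ.+ y i) ℚ.- (x j ℚ.+ y j) ∣
          ≡⟨ cong ∣_∣ (solve 4 (λ a b c d → (a :+ b) :+ :- (c :+ d) := (a :+ :- c) :+ (b :+ :- d))
                             refl (x i) (y i) (x j) (y j)) ⟩
        ∣ (x i ℚ.- x j) ℚ.+ (y i ℚ.- y j) ∣
          ≤⟨ ℚP.∣p+q∣≤∣p∣+∣q∣ (x i ℚ.- x j) (y i ℚ.- y j) ⟩
        ∣ x i ℚ.- x j ∣ ℚ.+ ∣ y i ℚ.- y j ∣
          ≤⟨ ℚP.+-mono-≤ (p i j (ℕP.m⊔n≤o⇒m≤o N₁ N₂ N≤i) (ℕP.m⊔n≤o⇒m≤o N₁ N₂ N≤j))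
                         (q i j (ℕP.m⊔n≤o⇒n≤o N₁ N₂ N≤i) (ℕP.m⊔n≤o⇒n≤o N₁ N₂ N≤j)) ⟩
        ½ ℚ.* ε ℚ.+ ½ ℚ.* ε
          ≡⟨ halves ε ⟩
        ε ∎
      where open ℚP.≤-Reasoning

    neg-cauchy : ∀ {x} → IsCauchy x → IsCauchy (λ i → ℚ.- x i)
    neg-cauchy {x} cx ε 0<ε =
      let N , p = cx ε 0<ε
      in N , λ i j N≤i N≤j → begin
        ∣ ℚ.- x i ℚ.- ℚ.- x j ∣
          ≡⟨ cong ∣_∣ (sym (ℚP.neg-distrib-+ (x i) (ℚ.- x j))) ⟩
        ∣ ℚ.- (x i ℚ.- x j) ∣
          ≡⟨ ℚP.∣-p∣≡∣p∣ (x i ℚ.- x j) ⟩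
        ∣ x i ℚ.- x j ∣
          ≤⟨ p i j N≤i N≤j ⟩
        ε ∎
      where open ℚP.≤-Reasoning

    eventually-bounded : ∀ {x} → IsCauchy x →
      ∃ λ B → ℚ.Positive B × ∃ λ N → ∀ i → N ℕ.≤ i → ∣ x i ∣ ℚ.≤ B
    eventually-bounded {x} cx =
      let N , p = cx 1ℚ (ℚP.positive⁻¹ 1ℚ)
      in 1ℚ ℚ.+ ∣ x N ∣
       , ℚ.positive (ℚP.+-mono-<-≤ {0ℚ} {1ℚ} (ℚP.positive⁻¹ 1ℚ) (ℚP.0≤∣p∣ (x N)))
       , N
       , λ i N≤i → begin
        ∣ x i ∣
          ≡⟨ cong ∣_∣ (solve 2 (λ a b → a := (a :+ :- b) :+ b) refl (x i) (x N)) ⟩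
        ∣ (x i ℚ.- x N) ℚ.+ x N ∣
          ≤⟨ ℚP.∣p+q∣≤∣p∣+∣q∣ (x i ℚ.- x N) (x N) ⟩
        ∣ x i ℚ.- x N ∣ ℚ.+ ∣ x N ∣
          ≤⟨ ℚP.+-monoˡ-≤ ∣ x N ∣ (p i N N≤i ℕP.≤-refl) ⟩
        1ℚ ℚ.+ ∣ x N ∣ ∎
      where open ℚP.≤-Reasoning

    scale : ∀ B → .{{_ : ℚ.Positive B}} → .{{_ : ℚ.NonZero B}} → ∀ ε {p q} →
            ∣ p ∣ ℚ.≤ B → ∣ q ∣ ℚ.≤ 1/ B ℚ.* ε → ∣ p ℚ.* q ∣ ℚ.≤ ε
    scale B ε {p} {q} p≤ q≤ = begin
      ∣ p ℚ.* q ∣         ≡⟨ ℚP.∣p*q∣≡∣p∣*∣q∣ p q ⟩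
      ∣ p ∣ ℚ.* ∣ q ∣     ≤⟨ ℚP.*-monoʳ-≤-nonNeg ∣ q ∣ {{ℚ.nonNegative (ℚP.0≤∣p∣ q)}} p≤ ⟩
      B ℚ.* ∣ q ∣         ≤⟨ ℚP.*-monoˡ-≤-nonNeg B {{ℚP.pos⇒nonNeg B}} q≤ ⟩
      B ℚ.* (1/ B ℚ.* ε)  ≡⟨ sym (ℚP.*-assoc B (1/ B) ε) ⟩
      (B ℚ.* 1/ B) ℚ.* ε  ≡⟨ cong (ℚ._* ε) (ℚP.*-inverseʳ B) ⟩
      1ℚ ℚ.* ε            ≡⟨ ℚP.*-identityˡ ε ⟩
      ε ∎
      where open ℚP.≤-Reasoning

    scaled : ∀ B → ℚ.Positive B → ∀ ε → 0ℚ ℚ.< ε →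
      ∃ λ η → 0ℚ ℚ.< η × (∀ p q → ∣ p ∣ ℚ.≤ B → ∣ q ∣ ℚ.≤ η → ∣ p ℚ.* q ∣ ℚ.≤ ε)
    scaled B B>0 ε 0<ε =
      let instance
            B-pos : ℚ.Positive B
            B-pos = B>0
            B-nonZero : ℚ.NonZero B
            B-nonZero = ℚP.pos⇒nonZero B
            1/B-pos : ℚ.Positive (1/ B)
            1/B-pos = ℚP.1/pos⇒pos B
      in 1/ B ℚ.* ε
       , subst (ℚ._< 1/ B ℚ.* ε) (ℚP.*-zeroʳ (1/ B)) (ℚP.*-monoʳ-<-pos (1/ B) 0<ε)
       , λ p q → scale B ε

    *-cauchy : ∀ {x y} → IsCauchy x → IsCauchy y → IsCauchy (λ i → x i ℚ.* y i)
    *-cauchy {x} {y} cx cy ε 0<ε =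
      let A , A>0 , M₁ , x≤A = eventually-bounded cx
          B , B>0 , M₂ , y≤B = eventually-bounded cy
          α , 0<α , scaleA = scaled A A>0 (½ ℚ.* ε) (half-pos 0<ε)
          β , 0<β , scaleB = scaled B B>0 (½ ℚ.* ε) (half-pos 0<ε)
          N₁ , p = cx β 0<β
          N₂ , q = cy α 0<α
          M = M₁ ℕ.⊔ M₂
          N = N₁ ℕ.⊔ N₂
      in M ℕ.⊔ N , λ i j K≤i K≤j →
        let M≤i = ℕP.m⊔n≤o⇒m≤o M N K≤i
            M≤j = ℕP.m⊔n≤o⇒m≤o M N K≤j
            N≤i = ℕP.m⊔n≤o⇒n≤o M N K≤i
            N≤j = ℕP.m⊔n≤o⇒n≤o M N K≤j
        in begin
        ∣ x i ℚ.* y i ℚ.- x j ℚ.* y j ∣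
          ≡⟨ cong ∣_∣ (solve 4 (λ a b c d → (a :* b) :+ :- (c :* d)
                                          := (a :* (b :+ :- d)) :+ (d :* (a :+ :- c)))
                             refl (x i) (y i) (x j) (y j)) ⟩
        ∣ x i ℚ.* (y i ℚ.- y j) ℚ.+ y j ℚ.* (x i ℚ.- x j) ∣
          ≤⟨ ℚP.∣p+q∣≤∣p∣+∣q∣ (x i ℚ.* (y i ℚ.- y j)) (y j ℚ.* (x i ℚ.- x j)) ⟩
        ∣ x i ℚ.* (y i ℚ.- y j) ∣ ℚ.+ ∣ y j ℚ.* (x i ℚ.- x j) ∣
          ≤⟨ ℚP.+-mono-≤
               (scaleA (x i) (y i ℚ.- y j) (x≤A i (ℕP.m⊔n≤o⇒m≤o M₁ M₂ M≤i))
                         (q i j (ℕP.m⊔n≤o⇒n≤o N₁ N₂ N≤i) (ℕP.m⊔n≤o⇒n≤o N₁ N₂ N≤j)))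
               (scaleB (y j) (x i ℚ.- x j) (y≤B j (ℕP.m⊔n≤o⇒n≤o M₁ M₂ M≤j))
                         (p i j (ℕP.m⊔n≤o⇒m≤o N₁ N₂ N≤i) (ℕP.m⊔n≤o⇒m≤o N₁ N₂ N≤j))) ⟩
        ½ ℚ.* ε ℚ.+ ½ ℚ.* ε
          ≡⟨ halves ε ⟩
        ε ∎
      where open ℚP.≤-Reasoning

infixl 6 _+ᴿ_ _-ᴿ_
infixl 7 _*ᴿ_
infix  8 -ᴿ_

_+ᴿ_ : ℝ → ℝ → ℝ
x +ᴿ y = mkℝ (λ i → seq x i ℚ.+ seq y i) (+-cauchy {seq x} {seq y} (cauchy x) (cauchy y))

-ᴿ_ : ℝ → ℝ
-ᴿ x = mkℝ (λ i → ℚ.- seq x i) (neg-cauchy {seq x} (cauchy x))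

_-ᴿ_ : ℝ → ℝ → ℝ
x -ᴿ y = x +ᴿ (-ᴿ y)

_*ᴿ_ : ℝ → ℝ → ℝ
x *ᴿ y = mkℝ (λ i → seq x i ℚ.* seq y i) (*-cauchy {seq x} {seq y} (cauchy x) (cauchy y))

------------------------------------------------------------------------
-- Euclidean space

Point : ℕ → Set
Point m = Vector ℝ m

_≈_ : ∀ {m} → Point m → Point m → Set
p ≈ q = ∀ k → p k ≃ q k

origin : ∀ {m} → Point m
origin _ = 0ᴿ

inner : ∀ {m} → Point m → Point m → ℝ
inner p q = foldr _+ᴿ_ 0ᴿ (λ k → p k *ᴿ q k)

_⊖_ : ∀ {m} → Point m → Point m → Point m
(p ⊖ q) k = p k -ᴿ q k

-- r is the distance |pq|, i.e. the nonnegative square root of the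
-- squared norm of p − q.
IsDistance : ∀ {m} → Point m → Point m → ℝ → Set
IsDistance p q r = 0ᴿ ≤ᴿ r × r *ᴿ r ≃ inner (p ⊖ q) (p ⊖ q)

-- The (m−1)-dimensional affine hyperplane { p | ⟨normal, p⟩ = offset }.
record Hyperplane (m : ℕ) : Set where
  field
    normal   : Point m
    offset   : ℝ
    normal≉0 : ¬ normal ≈ origin

_∈ᴴ_ : ∀ {m} → Point m → Hyperplane m → Set
p ∈ᴴ H = inner (Hyperplane.normal H) p ≃ Hyperplane.offset H

------------------------------------------------------------------------
-- Integral point sets

-- Distances are nonnegative, so "is an integer" is "is a natural number".
record IntegralPointSet (m n : ℕ) : Set where
  field
    point         : Fin n → Point m
    distinct      : Injective _≡_ _≈_ point
    integral      : ∀ i j → ∃ λ (d : ℕ) → IsDistance (point i) (point j) (fromℕ d)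
    nonDegenerate : ∀ (H : Hyperplane m) → ¬ (∀ i → point i ∈ᴴ H)

  distance : Fin n → Fin n → ℕ
  distance i j = proj₁ (integral i j)

diam : ∀ {m n} → IntegralPointSet m n → ℕ
diam {n = n} P = max 0 (cartesianProductWith distance (allFin n) (allFin n))
  where open IntegralPointSet P

IsDiameter : ℕ → ℕ → ℕ → Set
IsDiameter m n δ = Σ (IntegralPointSet m n) λ P → diam P ≡ δ

-- δ = d(m,n)
IsMinDiameter : ℕ → ℕ → ℕ → Set
IsMinDiameter m n δ = IsDiameter m n δ × (∀ δ′ → IsDiameter m n δ′ → δ ℕ.≤ δ′)

-- d(m,n) ≤ D.  The least element of a nonempty set of naturals exists only up
-- to double negation constructively, so d(m,n) is the relation IsMinDiameter
-- rather than a function.  Classically `attained` alone is equivalent to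
-- `exists` and `bounds` together; it is kept because it gives an actual
-- point set.
record d⟨_,_⟩≤_ (m n D : ℕ) : Set where
  field
    exists   : ¬ ¬ ∃ (IsMinDiameter m n)
    bounds   : ∀ δ → IsMinDiameter m n δ → δ ℕ.≤ D
    attained : Σ (IntegralPointSet m n) λ P → diam P ℕ.≤ D

{-# OPTIONS --safe #-}

-- Put k + 2 points on a line and, in hyperplanes orthogonal to it, two copies
-- of a regular simplex with m − 1 vertices, at distance √D from the line and
-- with edge a.  Such a simplex W exists in ℝ^(m−1) for every m as soon as
-- a² ≤ 2D.  Its second copy is either a translate of W along the line or −W;
-- then the distances are independent of m and only finitely many squares have
-- to be checked.
--   * k = 3, 4: D = 315/4, a = 6, and the second copy is W moved by 8.
--   * k ≥ 5: D = h² with h = 60 or 120, a = 6h/5, and the second copy is −W.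
--     Antipodal vertices are at distance 2h and (6h/5, 8h/5, 2h) is
--     Pythagorean.  The line points lie at integers t for which t² + h² is a
--     square, of which the smooth h supplies plenty.

module Submission where

open import Algebra.Bundles using (CommutativeRing)
open import Algebra.Bundles.Raw using (RawRing)
open import Algebra.Morphism.Structures using (module RingMorphisms)
import Algebra.Solver.Ring as RingSolver
open import Algebra.Solver.Ring.AlmostCommutativeRing
  using (fromCommutativeRing; _-Raw-AlmostCommutative⟶_)
open import Data.Empty using (⊥-elim)
open import Data.Fin using (Fin; zero; suc; inject≤)
open import Data.Fin.Properties as FinP using (all?; inject≤-injective)
open import Data.Integer as ℤ using (ℤ; +_; +[1+_]; -[1+_]; 0ℤ; 1ℤ; -1ℤ)
import Data.Integer.Properties as ℤP
import Data.Integer.Solver as ℤSolver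
open import Data.List using (allFin)
open import Data.List.Extrema.Nat using (max≤v⁺)
open import Data.List.Relation.Unary.All.Properties using (cartesianProductWith⁺)
open import Data.Maybe using (map)
open import Data.Nat as ℕ using (ℕ; zero; suc)
open import Data.Nat.Induction using (<-rec)
import Data.Nat.Properties as ℕP
open import Data.Nat.Tactic.RingSolver using (solve-∀)
open import Data.Product using (∃; _×_; _,_; proj₁; proj₂)
open import Data.Rational as ℚ using (ℚ; mkℚ; 0ℚ; 1ℚ; ½; ∣_∣; 1/_)
import Data.Rational.Properties as ℚP
import Data.Rational.Solver as ℚSolver
open import Data.Rational.Unnormalised as ℚᵘ using (mkℚᵘ)
import Data.Rational.Unnormalised.Properties as ℚᵘP
open import Data.Sum using (_⊎_; inj₁; inj₂)
open import Data.Sum.Function.Propositional using (_⊎-↔_)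
open import Data.Vec using ([]; _∷_; lookup)
open import Data.Vec.Functional using (Vector; tail) renaming (_∷_ to _∷ᵛ_)
open import Function.Bundles using (_↔_; module Inverse)
open import Function.Construct.Composition using (_↔-∘_)
open import Function.Construct.Identity using (↔-id)
open import Relation.Binary.PropositionalEquality as ≡ using (_≡_; _≢_)
open import Relation.Nullary using (¬_; Dec; yes; no)
open import Relation.Nullary.Decidable using (True; toWitness; dec⇒maybe; _→-dec_; _×-dec_)

-- Points with coordinates in a commutative ring

ℤ-rawRing : RawRing _ _
ℤ-rawRing = CommutativeRing.rawRing ℤP.+-*-commutativeRing

-- The Kronecker delta takes integer values, so that all Gram entries can be computed in ℤ, where
-- equality is decidable.
δ : ∀ {n} → Fin n → Fin n → ℤ
δ zero    zero    = 1ℤ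
δ zero    (suc _) = 0ℤ
δ (suc _) zero    = 0ℤ
δ (suc i) (suc j) = δ i j

δ-refl : ∀ {n} (i : Fin n) → δ i i ≡ 1ℤ
δ-refl zero    = ≡.refl
δ-refl (suc i) = δ-refl i

δ-≢ : ∀ {n} {i j : Fin n} → i ≢ j → δ i j ≡ 0ℤ
δ-≢ {i = zero}  {zero}  i≢j with () ← i≢j ≡.refl
δ-≢ {i = zero}  {suc j} i≢j = ≡.refl
δ-≢ {i = suc i} {zero}  i≢j = ≡.refl
δ-≢ {i = suc i} {suc j} i≢j = δ-≢ λ i≡j → i≢j (≡.cong suc i≡j)

-- The ring will be ℝ.  Keeping it abstract stops Agda from unfolding its
-- equality to Cauchy sequences, which would defeat unification.
module Frame {c ℓ} (R : CommutativeRing c ℓ)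
  (e : ℤ → CommutativeRing.Carrier R)
  (e-hom : RingMorphisms.IsRingHomomorphism ℤ-rawRing (CommutativeRing.rawRing R) e)
  where

  open CommutativeRing R hiding (zero)
  open RingMorphisms.IsRingHomomorphism e-hom
  open import Algebra.Properties.Semiring.Sum semiring
    using (sum; sum-cong-≋; sum-replicate-zero; ∑-distrib-+; *-distribˡ-sum)
  open import Relation.Binary.Reasoning.Setoid setoid

  -- Equality in the ring need not be decidable, so its solver takes coefficients from ℤ along this
  -- map.
  ℤ⟶R : ℤ-rawRing -Raw-AlmostCommutative⟶ fromCommutativeRing R
  ℤ⟶R = record
    { ⟦_⟧ = e ; +-homo = +-homo ; *-homo = *-homo ; -‿homo = -‿homo
    ; 0-homo = 0#-homo ; 1-homo = 1#-homo }

  open RingSolver ℤ-rawRing (fromCommutativeRing R) ℤ⟶R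
    (λ x y → map (λ x≡y → reflexive (≡.cong e x≡y)) (dec⇒maybe (x ℤ.≟ y)))
    using (solve; _:=_; _:+_; _:*_; _:-_; con)

  -- Sums and inner products

  ⟨_,_⟩ : ∀ {n} → Vector Carrier n → Vector Carrier n → Carrier
  ⟨ u , v ⟩ = sum (λ k → u k * v k)

  sum-linear : ∀ {n} x (u : Vector Carrier n) y v →
               sum (λ k → x * u k + y * v k) ≈ x * sum u + y * sum v
  sum-linear x u y v = trans (∑-distrib-+ (λ k → x * u k) (λ k → y * v k))
    (+-cong (sym (*-distribˡ-sum x u)) (sym (*-distribˡ-sum y v)))

  sum-const : ∀ n x → sum {n} (λ _ → x) ≈ e (+ n) * x
  sum-const zero    x = sym (trans (*-congʳ 0#-homo) (zeroˡ x))
  sum-const (suc n) x = begin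
    x + sum {n} (λ _ → x)  ≈⟨ +-congˡ (sum-const n x) ⟩
    x + e (+ n) * x        ≈⟨ solve 2 (λ x n → x :+ n :* x := (con 1ℤ :+ n) :* x) refl x (e (+ n)) ⟩
    (e 1ℤ + e (+ n)) * x   ≈⟨ *-congʳ (sym (+-homo 1ℤ (+ n))) ⟩
    e (+ suc n) * x        ∎

  sum-δ : ∀ {n} (i : Fin n) u → sum (λ k → e (δ i k) * u k) ≈ u i
  sum-δ {suc n} zero u = begin
    e 1ℤ * u zero + sum (λ k → e 0ℤ * u (suc k))
      ≈⟨ +-cong (*-congʳ 1#-homo) (sum-cong-≋ λ k → trans (*-congʳ 0#-homo) (zeroˡ (u (suc k)))) ⟩
    1# * u zero + sum {n} (λ _ → 0#)
      ≈⟨ +-cong (*-identityˡ _) (sum-replicate-zero n) ⟩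
    u zero + 0#
      ≈⟨ +-identityʳ _ ⟩
    u zero ∎
  sum-δ {suc n} (suc i) u = begin
    e 0ℤ * u zero + sum (λ k → e (δ i k) * u (suc k))
      ≈⟨ +-cong (trans (*-congʳ 0#-homo) (zeroˡ (u zero))) (sum-δ i (tail u)) ⟩
    0# + u (suc i)
      ≈⟨ +-identityˡ _ ⟩
    u (suc i) ∎

  -- Polarisation: distances depend on Gram entries alone. The factor `h` will be ½, since points
  -- are stored doubled.
  scaled-distance² : ∀ {n} h (p q : Vector Carrier n) →
    let d = λ k → h * p k - h * q k in
    ⟨ d , d ⟩ ≈ (h * h) * ((⟨ p , p ⟩ + ⟨ q , q ⟩) - (⟨ p , q ⟩ + ⟨ p , q ⟩))
  scaled-distance² {zero} h p q = begin
    0#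
      ≈⟨ sym (zeroʳ (h * h)) ⟩
    (h * h) * 0#
      -- The solver treats `0#` as a variable z, hence the trailing z, which is removed in the next
      -- line.
      ≈⟨ *-congˡ (solve 1 (λ z → z := (z :+ z) :- (z :+ z) :+ z) refl 0#) ⟩
    (h * h) * (((0# + 0#) - (0# + 0#)) + 0#)
      ≈⟨ *-congˡ (+-identityʳ _) ⟩
    (h * h) * ((0# + 0#) - (0# + 0#)) ∎
  scaled-distance² {suc n} h p q = begin
    d zero * d zero + ⟨ tail d , tail d ⟩
      ≈⟨ +-congˡ (scaled-distance² h (tail p) (tail q)) ⟩
    _ ≈⟨ solve 6 (λ h x y P Q C →
           (h :* x :- h :* y) :* (h :* x :- h :* y) :+ (h :* h) :* ((P :+ Q) :- (C :+ C))
             := (h :* h) :* (((x :* x :+ P) :+ (y :* y :+ Q)) :- ((x :* y :+ C) :+ (x :* y :+ C))))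
           refl h (p zero) (q zero) ⟨ tail p , tail p ⟩ ⟨ tail q , tail q ⟩ ⟨ tail p , tail q ⟩ ⟩
    (h * h) * ((⟨ p , p ⟩ + ⟨ q , q ⟩) - (⟨ p , q ⟩ + ⟨ p , q ⟩)) ∎
    where
    d : Vector Carrier (suc n)
    d k = h * p k - h * q k

  -- With S² = A² + nC and β = (S − A)/n, the n vectors W i = A eᵢ + β(1,…,1)
  -- have Gram matrix A²·I + C·J, because β(A + S) = C.

  module Simplex {n : ℕ} (a² C : ℤ) (A S ν : Carrier)
    (A² : A * A ≈ e a²)
    (S² : S * S ≈ e (a² ℤ.+ + n ℤ.* C))
    (nν : ν * e (+ n) ≈ 1#)
    where

    β : Carrier
    β = ν * (S - A)

    W : Fin n → Vector Carrier n
    W i k = A * e (δ i k) + β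

    nβ : e (+ n) * β ≈ S - A
    nβ = begin
      e (+ n) * (ν * (S - A))   ≈⟨ solve 3 (λ n ν x → n :* (ν :* x) := (ν :* n) :* x) refl (e (+ n)) ν (S - A) ⟩
      (ν * e (+ n)) * (S - A)   ≈⟨ *-congʳ nν ⟩
      1# * (S - A)              ≈⟨ *-identityˡ _ ⟩
      S - A                     ∎

    β[A+S] : β * (A + S) ≈ e C
    β[A+S] = begin
      (ν * (S - A)) * (A + S)
        ≈⟨ solve 3 (λ ν S A → (ν :* (S :- A)) :* (A :+ S) := ν :* (S :* S :- A :* A)) refl ν S A ⟩
      ν * (S * S - A * A)
        ≈⟨ *-congˡ (+-cong (trans S² (+-homo _ _)) (-‿cong A²)) ⟩
      ν * ((e a² + e (+ n ℤ.* C)) - e a²)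
        ≈⟨ *-congˡ (solve 2 (λ x y → (x :+ y) :- x := y) refl (e a²) (e (+ n ℤ.* C))) ⟩
      ν * e (+ n ℤ.* C)
        ≈⟨ *-congˡ (*-homo (+ n) C) ⟩
      ν * (e (+ n) * e C)
        ≈⟨ sym (*-assoc ν (e (+ n)) (e C)) ⟩
      (ν * e (+ n)) * e C
        ≈⟨ *-congʳ nν ⟩
      1# * e C
        ≈⟨ *-identityˡ _ ⟩
      e C ∎

    ⟨W,_⟩ : ∀ u i → ⟨ W i , u ⟩ ≈ A * u i + β * sum u
    ⟨W,_⟩ u i = begin
      sum (λ k → (A * e (δ i k) + β) * u k)
        ≈⟨ sum-cong-≋ (λ k → solve 4 (λ A d β u → (A :* d :+ β) :* u := A :* (d :* u) :+ β :* u)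
                           refl A (e (δ i k)) β (u k)) ⟩
      sum (λ k → A * (e (δ i k) * u k) + β * u k)
        ≈⟨ sum-linear A (λ k → e (δ i k) * u k) β u ⟩
      A * sum (λ k → e (δ i k) * u k) + β * sum u
        ≈⟨ +-congʳ (*-congˡ (sum-δ i u)) ⟩
      A * u i + β * sum u ∎

    -- The sum is A + nβ. So S is the eigenvalue of the matrix A·I + β·J at (1,...,1), and A is its
    -- eigenvalue on the orthogonal complement; this is why `orthogonal⇒0` cancels exactly these
    -- two.
    ΣW : ∀ i → sum (W i) ≈ S
    ΣW i = begin
      sum (W i)
        ≈⟨ sum-cong-≋ (λ k → solve 3 (λ A d β → A :* d :+ β := A :* (d :* con 1ℤ) :+ β :* con 1ℤ)
                           refl A (e (δ i k)) β) ⟩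
      sum (λ k → A * (e (δ i k) * e 1ℤ) + β * e 1ℤ)
        ≈⟨ sum-linear A (λ k → e (δ i k) * e 1ℤ) β (λ _ → e 1ℤ) ⟩
      A * sum (λ k → e (δ i k) * e 1ℤ) + β * sum {n} (λ _ → e 1ℤ)
        ≈⟨ +-cong (*-congˡ (sum-δ i (λ _ → e 1ℤ))) (*-congˡ (sum-const n (e 1ℤ))) ⟩
      A * e 1ℤ + β * (e (+ n) * e 1ℤ)
        ≈⟨ solve 3 (λ A β n → A :* con 1ℤ :+ β :* (n :* con 1ℤ) := A :+ n :* β) refl A β (e (+ n)) ⟩
      A + e (+ n) * β
        ≈⟨ +-congˡ nβ ⟩
      A + (S - A)
        ≈⟨ solve 2 (λ A S → A :+ (S :- A) := S) refl A S ⟩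
      S ∎

    -- The arguments of `δ` are swapped because `⟨W,_⟩` evaluates `W j` at coordinate `i`.
    gram : ∀ i j → ⟨ W i , W j ⟩ ≈ e (a² ℤ.* δ j i ℤ.+ C)
    gram i j = begin
      ⟨ W i , W j ⟩
        ≈⟨ ⟨W,_⟩ (W j) i ⟩
      A * (A * e (δ j i) + β) + β * sum (W j)
        ≈⟨ +-congˡ (*-congˡ (ΣW j)) ⟩
      A * (A * e (δ j i) + β) + β * S
        ≈⟨ solve 4 (λ A d β S → A :* (A :* d :+ β) :+ β :* S := (A :* A) :* d :+ β :* (A :+ S))
             refl A (e (δ j i)) β S ⟩
      (A * A) * e (δ j i) + β * (A + S)
        ≈⟨ +-cong (*-congʳ A²) β[A+S] ⟩
      e a² * e (δ j i) + e C
        ≈⟨ sym (trans (+-homo _ C) (+-congʳ (*-homo a² (δ j i)))) ⟩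
      e (a² ℤ.* δ j i ℤ.+ C) ∎

    -- If u is orthogonal to every W i, summing A uᵢ + β Σu = 0 over i gives S Σu = 0.
    orthogonal⇒0 : (∀ {x} → A * x ≈ 0# → x ≈ 0#) → (∀ {x} → S * x ≈ 0# → x ≈ 0#) →
                   ∀ u → (∀ i → ⟨ W i , u ⟩ ≈ 0#) → ∀ k → u k ≈ 0#
    orthogonal⇒0 A-cancel S-cancel u u⊥W k = A-cancel (begin
      A * u k               ≈⟨ sym (+-identityʳ _) ⟩
      A * u k + 0#          ≈⟨ +-congˡ (sym (trans (*-congˡ Σu≈0) (zeroʳ β))) ⟩
      A * u k + β * sum u     ≈⟨ relation k ⟩
      0#                    ∎)
      where
      relation : ∀ i → A * u i + β * sum u ≈ 0#
      relation i = trans (sym (⟨W,_⟩ u i)) (u⊥W i)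

      Σu≈0 : sum u ≈ 0#
      Σu≈0 = S-cancel (begin
        S * sum u
          ≈⟨ solve 3 (λ S A σ → S :* σ := A :* σ :+ (S :- A) :* σ) refl S A (sum u) ⟩
        A * sum u + (S - A) * sum u
          ≈⟨ +-congˡ (*-congʳ (sym nβ)) ⟩
        A * sum u + (e (+ n) * β) * sum u
          ≈⟨ +-congˡ (solve 3 (λ n β σ → (n :* β) :* σ := β :* (n :* σ)) refl (e (+ n)) β (sum u)) ⟩
        A * sum u + β * (e (+ n) * sum u)
          ≈⟨ +-congˡ (*-congˡ (sym (sum-const n (sum u)))) ⟩
        A * sum u + β * sum {n} (λ _ → sum u)
          ≈⟨ sym (sum-linear A u β (λ _ → sum u)) ⟩
        sum (λ i → A * u i + β * sum u)
          ≈⟨ sum-cong-≋ relation ⟩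
        sum {n} (λ _ → 0#)
          ≈⟨ sum-replicate-zero n ⟩
        0# ∎)

    -- Labelled points: distances and affine span

    module Points
      (½ : Carrier) (2½ : e (+ 2) * ½ ≈ 1#)
      (e-cancel : ∀ z → z ≢ 0ℤ → ∀ {x} → e z * x ≈ 0# → x ≈ 0#)
      (a²≢0 : a² ≢ 0ℤ) (nonzero-S² : a² ℤ.+ + n ℤ.* C ≢ 0ℤ)
      where

      -- (X , s , i) stands for the point ½ (X , s W i).
      Label : Set
      Label = ℤ × ℤ × Fin n

      -- The doubled point: feet may lie at half-integers, and doubling makes first coordinates and
      -- inner products integers.
      vec : Label → Vector Carrier (suc n)
      vec (X , s , i) = e X ∷ᵛ λ k → e s * W i k

      point : Label → Vector Carrier (suc n)
      point P k = ½ * vec P k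

      infixl 7 _∙_
      -- The inner product of doubled points as an integer, which turns each distance condition into
      -- an equation in ℤ.
      _∙_ : Label → Label → ℤ
      (X , s , i) ∙ (Y , t , j) = X ℤ.* Y ℤ.+ s ℤ.* t ℤ.* (a² ℤ.* δ j i ℤ.+ C)

      ⟨vec,vec⟩ : ∀ P Q → ⟨ vec P , vec Q ⟩ ≈ e (P ∙ Q)
      ⟨vec,vec⟩ (X , s , i) (Y , t , j) = begin
        e X * e Y + sum (λ k → (e s * W i k) * (e t * W j k))
          ≈⟨ +-congˡ (sum-cong-≋ λ k → solve 4 (λ s w t w′ → (s :* w) :* (t :* w′) := (s :* t) :* (w :* w′))
                       refl (e s) (W i k) (e t) (W j k)) ⟩
        e X * e Y + sum (λ k → (e s * e t) * (W i k * W j k))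
          ≈⟨ +-congˡ (trans (sym (*-distribˡ-sum (e s * e t) λ k → W i k * W j k)) (*-congˡ (gram i j))) ⟩
        e X * e Y + (e s * e t) * e (a² ℤ.* δ j i ℤ.+ C)
          ≈⟨ sym (trans (+-homo _ _) (+-cong (*-homo X Y)
                   (trans (*-homo (s ℤ.* t) _) (*-congʳ (*-homo s t))))) ⟩
        e ((X , s , i) ∙ (Y , t , j)) ∎

      -- Both sides of the hypothesis refer to doubled points, so they are four times the squares
      -- wanted; the two factors ½ remove this.
      distance² : ∀ P Q d → (P ∙ P ℤ.+ Q ∙ Q) ℤ.- (P ∙ Q ℤ.+ P ∙ Q) ≡ (+ 2 ℤ.* d) ℤ.* (+ 2 ℤ.* d) →
                  let p-q = λ k → point P k - point Q k in
                  ⟨ p-q , p-q ⟩ ≈ e d * e d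
      distance² P Q d eq = trans (scaled-distance² ½ (vec P) (vec Q)) (begin
        (½ * ½) * ((⟨ vec P , vec P ⟩ + ⟨ vec Q , vec Q ⟩) - (⟨ vec P , vec Q ⟩ + ⟨ vec P , vec Q ⟩))
          ≈⟨ *-congˡ (+-cong (+-cong (⟨vec,vec⟩ P P) (⟨vec,vec⟩ Q Q))
                             (-‿cong (+-cong (⟨vec,vec⟩ P Q) (⟨vec,vec⟩ P Q)))) ⟩
        (½ * ½) * ((e (P ∙ P) + e (Q ∙ Q)) - (e (P ∙ Q) + e (P ∙ Q)))
          ≈⟨ *-congˡ (sym (trans (+-homo _ _) (+-cong (+-homo _ _) (trans (-‿homo _) (-‿cong (+-homo _ _)))))) ⟩
        (½ * ½) * e ((P ∙ P ℤ.+ Q ∙ Q) ℤ.- (P ∙ Q ℤ.+ P ∙ Q))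
          ≈⟨ *-congˡ (reflexive (≡.cong e eq)) ⟩
        (½ * ½) * e ((+ 2 ℤ.* d) ℤ.* (+ 2 ℤ.* d))
          ≈⟨ *-congˡ (trans (*-homo _ _) (*-cong (*-homo _ _) (*-homo _ _))) ⟩
        (½ * ½) * ((e (+ 2) * e d) * (e (+ 2) * e d))
          ≈⟨ solve 3 (λ h t d → (h :* h) :* ((t :* d) :* (t :* d)) := ((t :* h) :* (t :* h)) :* (d :* d))
               refl ½ (e (+ 2)) (e d) ⟩
        ((e (+ 2) * ½) * (e (+ 2) * ½)) * (e d * e d)
          ≈⟨ *-congʳ (*-cong 2½ 2½) ⟩
        (1# * 1#) * (e d * e d)
          ≈⟨ trans (*-congʳ (*-identityˡ 1#)) (*-identityˡ _) ⟩
        e d * e d ∎)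

      -- Only the square of `r` is known; multiplying by `r` once more leaves an integer to cancel.
      root-cancel : ∀ {r z} → r * r ≈ e z → z ≢ 0ℤ → ∀ {x} → r * x ≈ 0# → x ≈ 0#
      root-cancel {r} {z} r² z≢0 {x} rx≈0 = e-cancel z z≢0 (begin
        e z * x      ≈⟨ *-congʳ (sym r²) ⟩
        (r * r) * x  ≈⟨ *-assoc r r x ⟩
        r * (r * x)  ≈⟨ *-congˡ rx≈0 ⟩
        r * 0#       ≈⟨ zeroʳ r ⟩
        0#           ∎)

      -- Two points of the axis differ only in the line direction, which forces the first coordinate
      -- of `v` to vanish, and `o` with it. Then the vertices, wherever their foot lies, show that
      -- `tail v` is orthogonal to every `W j`.
      spanning : ∀ {X Y F i} → X ≢ Y → ∀ v o →
                 ⟨ v , point (X , 0ℤ , i) ⟩ ≈ o → ⟨ v , point (Y , 0ℤ , i) ⟩ ≈ o →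
                 (∀ j → ⟨ v , point (F , 1ℤ , j) ⟩ ≈ o) → ∀ k → v k ≈ 0#
      spanning {X} {Y} {F} {i} X≢Y v o X∈ Y∈ W∈ = λ where
          zero    → v₀≈0
          (suc k) → orthogonal⇒0 (root-cancel A² a²≢0) (root-cancel S² nonzero-S²)
                      (tail v) v⊥W k
        where
        value : ∀ P → let Z , s , j = P in
                ⟨ v , point P ⟩ ≈ ½ * (e Z * v zero + e s * ⟨ W j , tail v ⟩)
        value (Z , s , j) = begin
          v zero * (½ * e Z) + sum (λ k → v (suc k) * (½ * (e s * W j k)))
            ≈⟨ +-congˡ (sum-cong-≋ λ k → solve 4 (λ v h s w → v :* (h :* (s :* w)) := (h :* s) :* (w :* v))
                          refl (v (suc k)) ½ (e s) (W j k)) ⟩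
          v zero * (½ * e Z) + sum (λ k → (½ * e s) * (W j k * v (suc k)))
            ≈⟨ +-congˡ (sym (*-distribˡ-sum (½ * e s) λ k → W j k * v (suc k))) ⟩
          v zero * (½ * e Z) + (½ * e s) * ⟨ W j , tail v ⟩
            ≈⟨ solve 5 (λ v h z s σ → v :* (h :* z) :+ (h :* s) :* σ := h :* (z :* v :+ s :* σ))
                 refl (v zero) ½ (e Z) (e s) ⟨ W j , tail v ⟩ ⟩
          ½ * (e Z * v zero + e s * ⟨ W j , tail v ⟩) ∎

        ½-cancel : ∀ {x} → ½ * x ≈ 0# → x ≈ 0#
        ½-cancel {x} ½x≈0 = begin
          x                  ≈⟨ sym (*-identityˡ x) ⟩
          1# * x             ≈⟨ *-congʳ (sym 2½) ⟩
          (e (+ 2) * ½) * x  ≈⟨ *-assoc _ ½ x ⟩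
          e (+ 2) * (½ * x)  ≈⟨ *-congˡ ½x≈0 ⟩
          e (+ 2) * 0#       ≈⟨ zeroʳ _ ⟩
          0#                 ∎

        on-axis : ∀ {Z} → ⟨ v , point (Z , 0ℤ , i) ⟩ ≈ o → ½ * (e Z * v zero) ≈ o
        on-axis {Z} Z∈ = begin
          ½ * (e Z * v zero)
            ≈⟨ solve 3 (λ x h σ → h :* x := h :* (x :+ con 0ℤ :* σ)) refl (e Z * v zero) ½ ⟨ W i , tail v ⟩ ⟩
          ½ * (e Z * v zero + e 0ℤ * ⟨ W i , tail v ⟩)
            ≈⟨ sym (value (Z , 0ℤ , i)) ⟩
          ⟨ v , point (Z , 0ℤ , i) ⟩
            ≈⟨ Z∈ ⟩
          o ∎

        v₀≈0 : v zero ≈ 0#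
        v₀≈0 = e-cancel (X ℤ.- Y) (λ X-Y≡0 → X≢Y (ℤP.i-j≡0⇒i≡j X Y X-Y≡0)) (½-cancel (begin
          ½ * (e (X ℤ.- Y) * v zero)
            ≈⟨ *-congˡ (*-congʳ (trans (+-homo X _) (+-congˡ (-‿homo Y)))) ⟩
          ½ * ((e X - e Y) * v zero)
            ≈⟨ solve 4 (λ h x y v → h :* ((x :- y) :* v) := h :* (x :* v) :- h :* (y :* v))
                 refl ½ (e X) (e Y) (v zero) ⟩
          ½ * (e X * v zero) - ½ * (e Y * v zero)
            ≈⟨ +-cong (on-axis X∈) (-‿cong (on-axis Y∈)) ⟩
          o - o
            ≈⟨ -‿inverseʳ o ⟩
          0# ∎))

        o≈0 : o ≈ 0#
        o≈0 = begin
          o                   ≈⟨ sym (on-axis X∈) ⟩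
          ½ * (e X * v zero)  ≈⟨ *-congˡ (*-congˡ v₀≈0) ⟩
          ½ * (e X * 0#)      ≈⟨ trans (*-congˡ (zeroʳ _)) (zeroʳ ½) ⟩
          0#                  ∎

        v⊥W : ∀ j → ⟨ W j , tail v ⟩ ≈ 0#
        v⊥W j = ½-cancel (begin
          ½ * ⟨ W j , tail v ⟩
            ≈⟨ *-congˡ (solve 2 (λ f σ → σ := f :* con 0ℤ :+ con 1ℤ :* σ) refl (e F) ⟨ W j , tail v ⟩) ⟩
          ½ * (e F * e 0ℤ + e 1ℤ * ⟨ W j , tail v ⟩)
            ≈⟨ *-congˡ (+-congʳ (*-congˡ (trans 0#-homo (sym v₀≈0)))) ⟩
          ½ * (e F * v zero + e 1ℤ * ⟨ W j , tail v ⟩)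
            ≈⟨ sym (value (F , 1ℤ , j)) ⟩
          ⟨ v , point (F , 1ℤ , j) ⟩
            ≈⟨ trans (W∈ j) o≈0 ⟩
          0# ∎)

open import Defs

-- The real numbers

module _ where

  open ℚSolver.+-*-Solver using (solve; _:=_; _:+_; _:*_; :-_; con)

  -- Inequalities between rationals

  ∣x-y∣≤ε : ∀ {x y ε} → x ℚ.≤ y ℚ.+ ε → y ℚ.≤ x ℚ.+ ε → ∣ x ℚ.- y ∣ ℚ.≤ ε
  ∣x-y∣≤ε {x} {y} {ε} x≤y+ε y≤x+ε with ℚP.∣p∣≡p∨∣p∣≡-p (x ℚ.- y)
  ... | inj₁ eq = begin
    ∣ x ℚ.- y ∣            ≡⟨ eq ⟩
    x ℚ.- y                ≤⟨ ℚP.+-monoˡ-≤ (ℚ.- y) x≤y+ε ⟩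
    y ℚ.+ ε ℚ.- y          ≡⟨ solve 2 (λ y ε → y :+ ε :+ :- y := ε) ≡.refl y ε ⟩
    ε                      ∎
    where open ℚP.≤-Reasoning
  ... | inj₂ eq = begin
    ∣ x ℚ.- y ∣            ≡⟨ eq ⟩
    ℚ.- (x ℚ.- y)          ≡⟨ solve 2 (λ x y → :- (x :+ :- y) := y :+ :- x) ≡.refl x y ⟩
    y ℚ.- x                ≤⟨ ℚP.+-monoˡ-≤ (ℚ.- x) y≤x+ε ⟩
    x ℚ.+ ε ℚ.- x          ≡⟨ solve 2 (λ x ε → x :+ ε :+ :- x := ε) ≡.refl x ε ⟩
    ε                      ∎
    where open ℚP.≤-Reasoning

  *-mono-≤ : ∀ {p q r s} → 0ℚ ℚ.≤ p → 0ℚ ℚ.≤ s → p ℚ.≤ q → r ℚ.≤ s → p ℚ.* r ℚ.≤ q ℚ.* s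
  *-mono-≤ {p} {q} {r} {s} 0≤p 0≤s p≤q r≤s = ℚP.≤-trans
    (ℚP.*-monoˡ-≤-nonNeg p {{ℚ.nonNegative 0≤p}} r≤s)
    (ℚP.*-monoʳ-≤-nonNeg s {{ℚ.nonNegative 0≤s}} p≤q)

  -- Compares a lower with an upper approximation to the same square root, that of `q`.
  square-cancel-≤ : ∀ {x y} → 0ℚ ℚ.≤ x → 0ℚ ℚ.≤ y → ∀ {q} → x ℚ.* x ℚ.≤ q → q ℚ.< y ℚ.* y → x ℚ.≤ y
  square-cancel-≤ {x} {y} 0≤x 0≤y x²≤q q<y² with x ℚP.≤? y
  ... | yes x≤y = x≤y
  ... | no  x≰y = ⊥-elim (ℚP.<-irrefl ≡.refl (ℚP.<-≤-trans q<y²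
          (ℚP.≤-trans (*-mono-≤ 0≤y 0≤x y≤x y≤x) x²≤q)))
    where y≤x = ℚP.<⇒≤ (ℚP.≰⇒> x≰y)

  halve : ∀ {ε} → 0ℚ ℚ.< ε → ∃ λ η → 0ℚ ℚ.< η × η ℚ.+ η ≡ ε
  halve {ε} 0<ε = ½ ℚ.* ε
    , ≡.subst (ℚ._< ½ ℚ.* ε) (ℚP.*-zeroʳ ½) (ℚP.*-monoʳ-<-pos ½ 0<ε)
    , ≡.trans (≡.sym (ℚP.*-distribʳ-+ ε ½ ½)) (ℚP.*-identityˡ ε)

  bounded*small : ∀ {B} → 0ℚ ℚ.< B → ∀ {ε} → 0ℚ ℚ.< ε →
    ∃ λ η → 0ℚ ℚ.< η × (∀ p q → ∣ p ∣ ℚ.≤ B → ∣ q ∣ ℚ.≤ η → ∣ p ℚ.* q ∣ ℚ.≤ ε)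
  bounded*small {B} 0<B {ε} 0<ε =
      1/ B ℚ.* ε
    , ≡.subst (ℚ._< 1/ B ℚ.* ε) (ℚP.*-zeroʳ (1/ B)) (ℚP.*-monoʳ-<-pos (1/ B) 0<ε)
    , λ p q p≤B q≤η → begin
        ∣ p ℚ.* q ∣         ≡⟨ ℚP.∣p*q∣≡∣p∣*∣q∣ p q ⟩
        ∣ p ∣ ℚ.* ∣ q ∣     ≤⟨ *-mono-≤ (ℚP.0≤∣p∣ p) (ℚP.≤-trans (ℚP.0≤∣p∣ q) q≤η) p≤B q≤η ⟩
        B ℚ.* (1/ B ℚ.* ε)  ≡⟨ ℚP.*-assoc B (1/ B) ε ⟨
        B ℚ.* 1/ B ℚ.* ε    ≡⟨ ≡.cong (ℚ._* ε) (ℚP.*-inverseʳ B) ⟩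
        1ℚ ℚ.* ε            ≡⟨ ℚP.*-identityˡ ε ⟩
        ε                   ∎
    where
    open ℚP.≤-Reasoning
    instance
      B-pos : ℚ.Positive B
      B-pos = ℚ.positive 0<B
      B-nonZero : ℚ.NonZero B
      B-nonZero = ℚP.pos⇒nonZero B
      1/B-pos : ℚ.Positive (1/ B)
      1/B-pos = ℚP.1/pos⇒pos B

  -- The ring ℝ

  ≡⇒≃ : ∀ {x y} → (∀ i → seq x i ≡ seq y i) → x ≃ y
  ≡⇒≃ {x} {y} x≡y ε 0<ε = 0 , λ i _ → begin
    ∣ seq x i ℚ.- seq y i ∣  ≡⟨ ≡.cong (λ z → ∣ z ℚ.- seq y i ∣) (x≡y i) ⟩
    ∣ seq y i ℚ.- seq y i ∣  ≡⟨ ≡.cong ∣_∣ (ℚP.+-inverseʳ (seq y i)) ⟩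
    0ℚ                       ≤⟨ ℚP.<⇒≤ 0<ε ⟩
    ε                        ∎
    where open ℚP.≤-Reasoning

  ≃-sym : ∀ {x y} → x ≃ y → y ≃ x
  ≃-sym {x} {y} x≃y ε 0<ε =
    let N , p = x≃y ε 0<ε
    in N , λ i N≤i → ≡.subst (ℚ._≤ ε)
         (≡.trans (≡.sym (ℚP.∣-p∣≡∣p∣ (seq x i ℚ.- seq y i)))
                  (≡.cong ∣_∣ (solve 2 (λ a b → :- (a :+ :- b) := b :+ :- a) ≡.refl (seq x i) (seq y i))))
         (p i N≤i)

  -- The ε/2 argument shared by transitivity and by the congruence of sums and products: the
  -- difference splits into two null sequences.
  close-to-sum : ∀ {x y} {a b : ℕ → ℚ} →
    (∀ i → seq x i ℚ.- seq y i ≡ a i ℚ.+ b i) →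
    (∀ ε → 0ℚ ℚ.< ε → ∃ λ N → ∀ i → N ℕ.≤ i → ∣ a i ∣ ℚ.≤ ε) →
    (∀ ε → 0ℚ ℚ.< ε → ∃ λ N → ∀ i → N ℕ.≤ i → ∣ b i ∣ ℚ.≤ ε) →
    x ≃ y
  close-to-sum {x} {y} {a} {b} eq a→0 b→0 ε 0<ε =
    let η , 0<η , η+η≡ε = halve 0<ε
        M , p = a→0 η 0<η
        N , q = b→0 η 0<η
    in M ℕ.⊔ N , λ i K≤i → begin
      ∣ seq x i ℚ.- seq y i ∣  ≡⟨ ≡.cong ∣_∣ (eq i) ⟩
      ∣ a i ℚ.+ b i ∣          ≤⟨ ℚP.∣p+q∣≤∣p∣+∣q∣ (a i) (b i) ⟩
      ∣ a i ∣ ℚ.+ ∣ b i ∣      ≤⟨ ℚP.+-mono-≤ (p i (ℕP.m⊔n≤o⇒m≤o M N K≤i)) (q i (ℕP.m⊔n≤o⇒n≤o M N K≤i)) ⟩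
      η ℚ.+ η                  ≡⟨ η+η≡ε ⟩
      ε                        ∎
    where open ℚP.≤-Reasoning

  ≃-trans : ∀ {x y z} → x ≃ y → y ≃ z → x ≃ z
  ≃-trans {x} {y} {z} = close-to-sum {x} {z} λ i →
    solve 3 (λ a b c → a :+ :- c := (a :+ :- b) :+ (b :+ :- c)) ≡.refl (seq x i) (seq y i) (seq z i)

  +ᴿ-cong : ∀ {x x′ y y′} → x ≃ x′ → y ≃ y′ → x +ᴿ y ≃ x′ +ᴿ y′
  +ᴿ-cong {x} {x′} {y} {y′} = close-to-sum {x +ᴿ y} {x′ +ᴿ y′} λ i →
    solve 4 (λ a a′ b b′ → (a :+ b) :+ :- (a′ :+ b′) := (a :+ :- a′) :+ (b :+ :- b′)) ≡.refl
      (seq x i) (seq x′ i) (seq y i) (seq y′ i)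

  -ᴿ-cong : ∀ {x y} → x ≃ y → -ᴿ x ≃ -ᴿ y
  -ᴿ-cong {x} {y} x≃y ε 0<ε =
    let N , p = ≃-sym {x} {y} x≃y ε 0<ε
    in N , λ i N≤i → ≡.subst (λ z → ∣ z ∣ ℚ.≤ ε)
         (solve 2 (λ a b → b :+ :- a := :- a :+ :- (:- b)) ≡.refl (seq x i) (seq y i)) (p i N≤i)

  eventually-bounded : ∀ x → ∃ λ B → 0ℚ ℚ.< B × ∃ λ N → ∀ i → N ℕ.≤ i → ∣ seq x i ∣ ℚ.≤ B
  eventually-bounded x =
    let N , p = cauchy x 1ℚ (ℚP.positive⁻¹ 1ℚ)
        c = seq x N
    in 1ℚ ℚ.+ ∣ c ∣
     , ℚP.+-mono-<-≤ (ℚP.positive⁻¹ 1ℚ) (ℚP.0≤∣p∣ c)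
     , N , λ i N≤i → begin
        ∣ seq x i ∣                  ≡⟨ ≡.cong ∣_∣ (solve 2 (λ a c → a := a :+ :- c :+ c) ≡.refl (seq x i) c) ⟩
        ∣ (seq x i ℚ.- c) ℚ.+ c ∣    ≤⟨ ℚP.∣p+q∣≤∣p∣+∣q∣ (seq x i ℚ.- c) c ⟩
        ∣ seq x i ℚ.- c ∣ ℚ.+ ∣ c ∣  ≤⟨ ℚP.+-monoˡ-≤ ∣ c ∣ (p i N N≤i ℕP.≤-refl) ⟩
        1ℚ ℚ.+ ∣ c ∣                 ∎
    where open ℚP.≤-Reasoning

  -- A Cauchy sequence is eventually bounded by some B, and the null sequence is eventually below
  -- ε/B.
  bounded*null : ∀ x {a : ℕ → ℚ} →
    (∀ ε → 0ℚ ℚ.< ε → ∃ λ N → ∀ i → N ℕ.≤ i → ∣ a i ∣ ℚ.≤ ε) →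
    (∀ ε → 0ℚ ℚ.< ε → ∃ λ N → ∀ i → N ℕ.≤ i → ∣ seq x i ℚ.* a i ∣ ℚ.≤ ε)
  bounded*null x {a} a→0 ε 0<ε =
    let B , 0<B , M , x≤B = eventually-bounded x
        η , 0<η , small = bounded*small 0<B 0<ε
        N , p = a→0 η 0<η
    in M ℕ.⊔ N , λ i K≤i →
         small (seq x i) (a i) (x≤B i (ℕP.m⊔n≤o⇒m≤o M N K≤i)) (p i (ℕP.m⊔n≤o⇒n≤o M N K≤i))

  *ᴿ-cong : ∀ {x x′ y y′} → x ≃ x′ → y ≃ y′ → x *ᴿ y ≃ x′ *ᴿ y′
  *ᴿ-cong {x} {x′} {y} {y′} x≃x′ y≃y′ = close-to-sum {x *ᴿ y} {x′ *ᴿ y′}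
    (λ i → solve 4 (λ a a′ b b′ → (a :* b) :+ :- (a′ :* b′)
                      := (b :* (a :+ :- a′)) :+ (a′ :* (b :+ :- b′))) ≡.refl
      (seq x i) (seq x′ i) (seq y i) (seq y′ i))
    (bounded*null y x≃x′) (bounded*null x′ y≃y′)

  -- The laws hold termwise in ℚ. Reals are passed explicitly because `≃` unfolds to sequences, from
  -- which the Cauchy proofs cannot be inferred.
  ℝ-commutativeRing : CommutativeRing _ _
  ℝ-commutativeRing = record
    { Carrier = ℝ ; _≈_ = _≃_ ; _+_ = _+ᴿ_ ; _*_ = _*ᴿ_ ; -_ = -ᴿ_ ; 0# = 0ᴿ ; 1# = fromℚ 1ℚ
    ; isCommutativeRing = record
      { isRing = record
        { +-isAbelianGroup = record
          { isGroup = record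
            { isMonoid = record
              { isSemigroup = record
                { isMagma = record
                  { isEquivalence = record
                    { refl  = λ {x} → ≡⇒≃ {x} {x} λ _ → ≡.refl
                    ; sym   = λ {x} {y} → ≃-sym {x} {y}
                    ; trans = λ {x} {y} {z} → ≃-trans {x} {y} {z}
                    }
                  ; ∙-cong = λ {x} {x′} {y} {y′} → +ᴿ-cong {x} {x′} {y} {y′}
                  }
                ; assoc = λ x y z → ≡⇒≃ {(x +ᴿ y) +ᴿ z} {x +ᴿ (y +ᴿ z)}
                    λ i → ℚP.+-assoc (seq x i) (seq y i) (seq z i)
                }
              ; identity = (λ x → ≡⇒≃ {0ᴿ +ᴿ x} {x} λ i → ℚP.+-identityˡ (seq x i))
                         , (λ x → ≡⇒≃ {x +ᴿ 0ᴿ} {x} λ i → ℚP.+-identityʳ (seq x i))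
              }
            ; inverse = (λ x → ≡⇒≃ {(-ᴿ x) +ᴿ x} {0ᴿ} λ i → ℚP.+-inverseˡ (seq x i))
                      , (λ x → ≡⇒≃ {x +ᴿ (-ᴿ x)} {0ᴿ} λ i → ℚP.+-inverseʳ (seq x i))
            ; ⁻¹-cong = λ {x} {y} → -ᴿ-cong {x} {y}
            }
          ; comm = λ x y → ≡⇒≃ {x +ᴿ y} {y +ᴿ x} λ i → ℚP.+-comm (seq x i) (seq y i)
          }
        ; *-cong = λ {x} {x′} {y} {y′} → *ᴿ-cong {x} {x′} {y} {y′}
        ; *-assoc = λ x y z → ≡⇒≃ {(x *ᴿ y) *ᴿ z} {x *ᴿ (y *ᴿ z)}
            λ i → ℚP.*-assoc (seq x i) (seq y i) (seq z i)
        ; *-identity = (λ x → ≡⇒≃ {fromℚ 1ℚ *ᴿ x} {x} λ i → ℚP.*-identityˡ (seq x i))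
                     , (λ x → ≡⇒≃ {x *ᴿ fromℚ 1ℚ} {x} λ i → ℚP.*-identityʳ (seq x i))
        ; distrib = (λ x y z → ≡⇒≃ {x *ᴿ (y +ᴿ z)} {x *ᴿ y +ᴿ x *ᴿ z}
            λ i → ℚP.*-distribˡ-+ (seq x i) (seq y i) (seq z i))
                  , (λ x y z → ≡⇒≃ {(y +ᴿ z) *ᴿ x} {y *ᴿ x +ᴿ z *ᴿ x}
                      λ i → ℚP.*-distribʳ-+ (seq x i) (seq y i) (seq z i))
        }
      ; *-comm = λ x y → ≡⇒≃ {x *ᴿ y} {y *ᴿ x} λ i → ℚP.*-comm (seq x i) (seq y i)
      }
    }

  module ℝR = CommutativeRing ℝ-commutativeRing

  -- Integers inside ℝ

  ℤ⇒ℚ : ℤ → ℚ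
  ℤ⇒ℚ z = z ℚ./ 1

  -- Normalised division is stuck on a variable numerator. The laws for `ℤ⇒ℚ` are therefore checked
  -- on unnormalised fractions with denominator 1 and carried back.
  toℚᵘ-ℤ⇒ℚ : ∀ z → ℚ.toℚᵘ (ℤ⇒ℚ z) ℚᵘ.≃ mkℚᵘ z 0
  toℚᵘ-ℤ⇒ℚ z = ℚP.toℚᵘ-fromℚᵘ (mkℚᵘ z 0)

  ℤ⇒ℚ-+ : ∀ x y → ℤ⇒ℚ (x ℤ.+ y) ≡ ℤ⇒ℚ x ℚ.+ ℤ⇒ℚ y
  ℤ⇒ℚ-+ x y = ℚP.toℚᵘ-injective (begin-equality
    ℚ.toℚᵘ (ℤ⇒ℚ (x ℤ.+ y))                   ≃⟨ toℚᵘ-ℤ⇒ℚ (x ℤ.+ y) ⟩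
    mkℚᵘ (x ℤ.+ y) 0                         ≃⟨ ℚᵘ.*≡* (≡.cong (ℤ._* 1ℤ)
                                                   (≡.sym (≡.cong₂ ℤ._+_ (ℤP.*-identityʳ x) (ℤP.*-identityʳ y)))) ⟩
    mkℚᵘ x 0 ℚᵘ.+ mkℚᵘ y 0                   ≃⟨ ℚᵘP.+-cong (toℚᵘ-ℤ⇒ℚ x) (toℚᵘ-ℤ⇒ℚ y) ⟨
    ℚ.toℚᵘ (ℤ⇒ℚ x) ℚᵘ.+ ℚ.toℚᵘ (ℤ⇒ℚ y)       ≃⟨ ℚP.toℚᵘ-homo-+ (ℤ⇒ℚ x) (ℤ⇒ℚ y) ⟨
    ℚ.toℚᵘ (ℤ⇒ℚ x ℚ.+ ℤ⇒ℚ y)                 ∎)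
    where open ℚᵘP.≤-Reasoning

  ℤ⇒ℚ-* : ∀ x y → ℤ⇒ℚ (x ℤ.* y) ≡ ℤ⇒ℚ x ℚ.* ℤ⇒ℚ y
  ℤ⇒ℚ-* x y = ℚP.toℚᵘ-injective (begin-equality
    ℚ.toℚᵘ (ℤ⇒ℚ (x ℤ.* y))                   ≃⟨ toℚᵘ-ℤ⇒ℚ (x ℤ.* y) ⟩
    mkℚᵘ x 0 ℚᵘ.* mkℚᵘ y 0                   ≃⟨ ℚᵘP.*-cong (toℚᵘ-ℤ⇒ℚ x) (toℚᵘ-ℤ⇒ℚ y) ⟨
    ℚ.toℚᵘ (ℤ⇒ℚ x) ℚᵘ.* ℚ.toℚᵘ (ℤ⇒ℚ y)       ≃⟨ ℚP.toℚᵘ-homo-* (ℤ⇒ℚ x) (ℤ⇒ℚ y) ⟨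
    ℚ.toℚᵘ (ℤ⇒ℚ x ℚ.* ℤ⇒ℚ y)                 ∎)
    where open ℚᵘP.≤-Reasoning

  ℤ⇒ℚ-neg : ∀ x → ℤ⇒ℚ (ℤ.- x) ≡ ℚ.- ℤ⇒ℚ x
  ℤ⇒ℚ-neg x = ℚP.toℚᵘ-injective (begin-equality
    ℚ.toℚᵘ (ℤ⇒ℚ (ℤ.- x))      ≃⟨ toℚᵘ-ℤ⇒ℚ (ℤ.- x) ⟩
    ℚᵘ.- mkℚᵘ x 0             ≃⟨ ℚᵘP.-‿cong (toℚᵘ-ℤ⇒ℚ x) ⟨
    ℚᵘ.- ℚ.toℚᵘ (ℤ⇒ℚ x)       ≃⟨ ℚP.toℚᵘ-homo‿- (ℤ⇒ℚ x) ⟨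
    ℚ.toℚᵘ (ℚ.- ℤ⇒ℚ x)        ∎)
    where open ℚᵘP.≤-Reasoning

  ℤ⇒ℚ-≢0 : ∀ {z} → z ≢ 0ℤ → ℤ⇒ℚ z ≢ 0ℚ
  ℤ⇒ℚ-≢0 {z} z≢0 eq with ℚᵘP.≃-trans (ℚᵘP.≃-sym (toℚᵘ-ℤ⇒ℚ z)) (ℚᵘP.≃-reflexive (≡.cong ℚ.toℚᵘ eq))
  ... | ℚᵘ.*≡* z*1≡0 = z≢0 (≡.trans (≡.sym (ℤP.*-identityʳ z)) z*1≡0)

  ℤ⇒ℚ-mono-< : ∀ {x y} → x ℤ.< y → ℤ⇒ℚ x ℚ.< ℤ⇒ℚ y
  ℤ⇒ℚ-mono-< {x} {y} x<y = ℚP.toℚᵘ-cancel-< (begin-strict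
    ℚ.toℚᵘ (ℤ⇒ℚ x)  ≃⟨ toℚᵘ-ℤ⇒ℚ x ⟩
    mkℚᵘ x 0        <⟨ ℚᵘ.*<* (≡.subst₂ ℤ._<_ (≡.sym (ℤP.*-identityʳ x)) (≡.sym (ℤP.*-identityʳ y)) x<y) ⟩
    mkℚᵘ y 0        ≃⟨ toℚᵘ-ℤ⇒ℚ y ⟨
    ℚ.toℚᵘ (ℤ⇒ℚ y)  ∎)
    where open ℚᵘP.≤-Reasoning

  ℤ⇒ℝ : ℤ → ℝ
  ℤ⇒ℝ z = fromℚ (ℤ⇒ℚ z)

  fromℚ-cong : ∀ {p q} → p ≡ q → fromℚ p ≃ fromℚ q
  fromℚ-cong {p} {q} p≡q = ≡⇒≃ {fromℚ p} {fromℚ q} λ _ → p≡q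

  ℤ⇒ℝ-isRingHomomorphism : RingMorphisms.IsRingHomomorphism ℤ-rawRing ℝR.rawRing ℤ⇒ℝ
  ℤ⇒ℝ-isRingHomomorphism = record
    { isSemiringHomomorphism = record
      { isNearSemiringHomomorphism = record
        { +-isMonoidHomomorphism = record
          { isMagmaHomomorphism = record
            { isRelHomomorphism = record { cong = λ x≡y → fromℚ-cong (≡.cong ℤ⇒ℚ x≡y) }
            ; homo = λ x y → ≡⇒≃ {ℤ⇒ℝ (x ℤ.+ y)} {ℤ⇒ℝ x +ᴿ ℤ⇒ℝ y} λ _ → ℤ⇒ℚ-+ x y
            }
          ; ε-homo = ℝR.refl {0ᴿ}
          }
        ; *-homo = λ x y → ≡⇒≃ {ℤ⇒ℝ (x ℤ.* y)} {ℤ⇒ℝ x *ᴿ ℤ⇒ℝ y} λ _ → ℤ⇒ℚ-* x y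
        }
      ; 1#-homo = ℝR.refl {fromℚ 1ℚ}
      }
    ; -‿homo = λ x → ≡⇒≃ {ℤ⇒ℝ (ℤ.- x)} { -ᴿ ℤ⇒ℝ x} λ _ → ℤ⇒ℚ-neg x
    }

  fromℚ-inverse : ∀ q → q ≢ 0ℚ → ∃ λ r → fromℚ q *ᴿ fromℚ r ≃ fromℚ 1ℚ
  fromℚ-inverse q q≢0 = 1/ q , ≡⇒≃ {fromℚ q *ᴿ fromℚ (1/ q)} {fromℚ 1ℚ} λ _ → ℚP.*-inverseʳ q
    where instance q-nonZero = ℚ.≢-nonZero q≢0

  ℤ⇒ℝ-cancel : ∀ z → z ≢ 0ℤ → ∀ {x} → ℤ⇒ℝ z *ᴿ x ≃ 0ᴿ → x ≃ 0ᴿ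
  ℤ⇒ℝ-cancel z z≢0 {x} zx≃0 = begin
    x                                       ≈⟨ ℝR.*-identityˡ x ⟨
    fromℚ 1ℚ *ᴿ x                           ≈⟨ ℝR.*-congʳ {x} {fromℚ q *ᴿ fromℚ r} {fromℚ 1ℚ} qr≃1 ⟨
    (fromℚ q *ᴿ fromℚ r) *ᴿ x               ≈⟨ ℝR.*-congʳ {x} {fromℚ q *ᴿ fromℚ r} {fromℚ r *ᴿ fromℚ q}
                                                    (ℝR.*-comm (fromℚ q) (fromℚ r)) ⟩
    (fromℚ r *ᴿ fromℚ q) *ᴿ x               ≈⟨ ℝR.*-assoc (fromℚ r) (fromℚ q) x ⟩
    fromℚ r *ᴿ (fromℚ q *ᴿ x)               ≈⟨ ℝR.*-congˡ {fromℚ r} {fromℚ q *ᴿ x} {0ᴿ} zx≃0 ⟩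
    fromℚ r *ᴿ 0ᴿ                           ≈⟨ ℝR.zeroʳ (fromℚ r) ⟩
    0ᴿ                                      ∎
    where
    open import Relation.Binary.Reasoning.Setoid ℝR.setoid
    q = ℤ⇒ℚ z
    r = proj₁ (fromℚ-inverse q (ℤ⇒ℚ-≢0 z≢0))
    qr≃1 = proj₂ (fromℚ-inverse q (ℤ⇒ℚ-≢0 z≢0))

  -- The sequence is constant, so if ∣q∣ were positive, a rational strictly between 0 and ∣q∣ would
  -- refute convergence to 0.
  fromℚ-injective₀ : ∀ {q} → fromℚ q ≃ 0ᴿ → q ≡ 0ℚ
  fromℚ-injective₀ {q} q≃0 with ∣ q ∣ ℚP.≤? 0ℚ
  ... | yes ∣q∣≤0 = ℚP.∣p∣≡0⇒p≡0 q (ℚP.≤-antisym ∣q∣≤0 (ℚP.0≤∣p∣ q))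
  ... | no  ∣q∣≰0 =
    let η , 0<η , η<∣q∣ = ℚP.<-dense (ℚP.≰⇒> ∣q∣≰0)
        N , p = q≃0 η 0<η
    in ⊥-elim (ℚP.<-irrefl ≡.refl (ℚP.<-≤-trans η<∣q∣
         (≡.subst (λ r → ∣ r ∣ ℚ.≤ η) (ℚP.+-identityʳ q) (p N ℕP.≤-refl))))

  -- Square roots

  reciprocal : ℕ → ℚ
  reciprocal k = + 1 ℚ./ suc k

  toℚᵘ-reciprocal : ∀ k → ℚ.toℚᵘ (reciprocal k) ℚᵘ.≃ mkℚᵘ (+ 1) k
  toℚᵘ-reciprocal k = ℚP.toℚᵘ-fromℚᵘ (mkℚᵘ (+ 1) k)

  reciprocal-pos : ∀ k → 0ℚ ℚ.< reciprocal k
  reciprocal-pos k = ℚP.toℚᵘ-cancel-< (ℚᵘP.<-respʳ-≃ (ℚᵘP.≃-sym (toℚᵘ-reciprocal k))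
    (ℚᵘ.*<* (ℤ.+<+ (ℕ.s≤s ℕ.z≤n))))

  reciprocal→0 : ∀ ε → 0ℚ ℚ.< ε → ∃ λ N → ∀ k → N ℕ.≤ k → reciprocal k ℚ.≤ ε
  -- For ε = (n+1)/d, every k ≥ d - 1 satisfies 1/(k+1) ≤ 1/d ≤ ε.
  reciprocal→0 (mkℚ +[1+ n ] d-1 _) _ = d-1 , λ k d≤k →
    ℚP.toℚᵘ-cancel-≤ (ℚᵘP.≤-respˡ-≃ (ℚᵘP.≃-sym (toℚᵘ-reciprocal k))
      (ℚᵘ.*≤* (ℤ.+≤+ (ℕP.*-mono-≤ (ℕ.s≤s (ℕ.z≤n {n})) (ℕ.s≤s d≤k)))))
  reciprocal→0 (mkℚ (+ 0) _ _)    (ℚ.*<* (ℤ.+<+ ()))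
  reciprocal→0 (mkℚ -[1+ _ ] _ _) (ℚ.*<* ())

  reciprocal-*-suc : ∀ k → ℤ⇒ℚ (+ suc k) ℚ.* reciprocal k ≡ 1ℚ
  reciprocal-*-suc k = ℚP.toℚᵘ-injective (begin-equality
    ℚ.toℚᵘ (ℤ⇒ℚ (+ suc k) ℚ.* reciprocal k)            ≃⟨ ℚP.toℚᵘ-homo-* (ℤ⇒ℚ (+ suc k)) (reciprocal k) ⟩
    ℚ.toℚᵘ (ℤ⇒ℚ (+ suc k)) ℚᵘ.* ℚ.toℚᵘ (reciprocal k)  ≃⟨ ℚᵘP.*-cong (toℚᵘ-ℤ⇒ℚ (+ suc k)) (toℚᵘ-reciprocal k) ⟩
    mkℚᵘ (+ suc k) 0 ℚᵘ.* mkℚᵘ (+ 1) k                 ≃⟨ ℚᵘ.*≡* (≡.trans (ℤP.*-assoc (+ suc k) 1ℤ 1ℤ)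
                                                             (≡.cong (λ z → + suc z) (k*1≡k+0+0 k))) ⟩
    ℚ.toℚᵘ 1ℚ                                          ∎)
    where
    open ℚᵘP.≤-Reasoning
    k*1≡k+0+0 : ∀ k → k ℕ.* 1 ≡ k ℕ.+ 0 ℕ.+ 0
    k*1≡k+0+0 k = ≡.trans (ℕP.*-identityʳ k) (≡.sym (≡.trans (ℕP.+-identityʳ (k ℕ.+ 0)) (ℕP.+-identityʳ k)))

  0≤ℤ⇒ℚ : ∀ j → 0ℚ ℚ.≤ ℤ⇒ℚ (+ j)
  0≤ℤ⇒ℚ zero    = ℚP.≤-refl
  0≤ℤ⇒ℚ (suc j) = ℚP.<⇒≤ (ℤ⇒ℚ-mono-< {0ℤ} {+ suc j} (ℤ.+<+ (ℕ.s≤s ℕ.z≤n)))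

  -- For w ≥ 0 this says x ≤ √q < x + w without mentioning the root.
  FloorSqrt : ℚ → ℚ → Set
  FloorSqrt q w = ∃ λ x → 0ℚ ℚ.≤ x × x ℚ.* x ℚ.≤ q × q ℚ.< (x ℚ.+ w) ℚ.* (x ℚ.+ w)

  -- The largest multiple of w with square at most q, sought downwards from j w.
  floorSqrt : ∀ q w → 0ℚ ℚ.≤ q → 0ℚ ℚ.≤ w → ∀ j →
              q ℚ.< (ℤ⇒ℚ (+ j) ℚ.* w) ℚ.* (ℤ⇒ℚ (+ j) ℚ.* w) → FloorSqrt q w
  floorSqrt q w 0≤q 0≤w zero q<0 = ⊥-elim (ℚP.<-irrefl ≡.refl (ℚP.≤-<-trans 0≤q
    (≡.subst (q ℚ.<_) (solve 1 (λ w → (con 0ℚ :* w) :* (con 0ℚ :* w) := con 0ℚ) ≡.refl w) q<0)))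
  floorSqrt q w 0≤q 0≤w (suc j) q<
    with q ℚP.<? (ℤ⇒ℚ (+ j) ℚ.* w) ℚ.* (ℤ⇒ℚ (+ j) ℚ.* w)
  ... | yes q<′ = floorSqrt q w 0≤q 0≤w j q<′
  ... | no  q≮  = ℤ⇒ℚ (+ j) ℚ.* w
    , ≡.subst (ℚ._≤ ℤ⇒ℚ (+ j) ℚ.* w) (ℚP.*-zeroˡ w)
        (ℚP.*-monoʳ-≤-nonNeg w {{ℚ.nonNegative 0≤w}} (0≤ℤ⇒ℚ j))
    , ℚP.≮⇒≥ q≮
    , ≡.subst (λ x → q ℚ.< x ℚ.* x) step q<
    where
    step : ℤ⇒ℚ (+ suc j) ℚ.* w ≡ ℤ⇒ℚ (+ j) ℚ.* w ℚ.+ w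
    step = ≡.trans (≡.cong (ℚ._* w) (ℤ⇒ℚ-+ 1ℤ (+ j)))
      (solve 2 (λ j w → (con 1ℚ :+ j) :* w := j :* w :+ w) ≡.refl (ℤ⇒ℚ (+ j)) w)

  module Sqrt (N : ℕ) where

    q : ℚ
    q = ℤ⇒ℚ (+ N)

    -- Opaque, so that type checking does not run the search.
    abstract
      approximation : ∀ k → FloorSqrt q (reciprocal k)
      -- The search starts at j = (N+1)(k+1), where j/(k+1) = N + 1 has a square above N.
      approximation k = floorSqrt q (reciprocal k) (0≤ℤ⇒ℚ N) (ℚP.<⇒≤ (reciprocal-pos k)) (suc N ℕ.* suc k)
        (≡.subst (λ x → q ℚ.< x ℚ.* x) (≡.sym bound)
          (≡.subst (q ℚ.<_) (ℤ⇒ℚ-* (+ suc N) (+ suc N))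
            (ℤ⇒ℚ-mono-< {+ N} {+ suc N ℤ.* + suc N} (ℤ.+<+ (ℕP.m≤m*n (suc N) (suc N))))))
        where
        open ≡.≡-Reasoning
        bound : ℤ⇒ℚ (+ (suc N ℕ.* suc k)) ℚ.* reciprocal k ≡ ℤ⇒ℚ (+ suc N)
        bound = begin
          ℤ⇒ℚ (+ (suc N ℕ.* suc k)) ℚ.* reciprocal k              ≡⟨ ≡.cong (ℚ._* reciprocal k) (ℤ⇒ℚ-* (+ suc N) (+ suc k)) ⟩
          (ℤ⇒ℚ (+ suc N) ℚ.* ℤ⇒ℚ (+ suc k)) ℚ.* reciprocal k      ≡⟨ ℚP.*-assoc (ℤ⇒ℚ (+ suc N)) _ _ ⟩
          ℤ⇒ℚ (+ suc N) ℚ.* (ℤ⇒ℚ (+ suc k) ℚ.* reciprocal k)      ≡⟨ ≡.cong (ℤ⇒ℚ (+ suc N) ℚ.*_) (reciprocal-*-suc k) ⟩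
          ℤ⇒ℚ (+ suc N) ℚ.* 1ℚ                                    ≡⟨ ℚP.*-identityʳ _ ⟩
          ℤ⇒ℚ (+ suc N)                                           ∎

    x : ℕ → ℚ
    x k = proj₁ (approximation k)

    0≤x : ∀ k → 0ℚ ℚ.≤ x k
    0≤x k = proj₁ (proj₂ (approximation k))

    x²≤q : ∀ k → x k ℚ.* x k ℚ.≤ q
    x²≤q k = proj₁ (proj₂ (proj₂ (approximation k)))

    q<[x+w]² : ∀ k → q ℚ.< (x k ℚ.+ reciprocal k) ℚ.* (x k ℚ.+ reciprocal k)
    q<[x+w]² k = proj₂ (proj₂ (proj₂ (approximation k)))

    -- Both sides are compared with √N: each x i lies below it and each x j + 1/(j+1) above. Used in
    -- both directions, this gives the Cauchy property.
    x≤x+w : ∀ i j → x i ℚ.≤ x j ℚ.+ reciprocal j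
    x≤x+w i j = square-cancel-≤ (0≤x i) (ℚP.+-mono-≤ (0≤x j) (ℚP.<⇒≤ (reciprocal-pos j)))
      (x²≤q i) (q<[x+w]² j)

    x-cauchy : IsCauchy x
    x-cauchy ε 0<ε =
      let N , w≤ε = reciprocal→0 ε 0<ε
      in N , λ i j N≤i N≤j → ∣x-y∣≤ε
        (ℚP.≤-trans (x≤x+w i j) (ℚP.+-monoʳ-≤ (x j) (w≤ε j N≤j)))
        (ℚP.≤-trans (x≤x+w j i) (ℚP.+-monoʳ-≤ (x i) (w≤ε i N≤i)))

    √ : ℝ
    √ = mkℝ x x-cauchy

    -- With w = 1/(k+1), the error N - x² lies between 0 and (2x + w)w, which is at most (2x + 1)w
    -- once w ≤ 1; here 2x + 1 is bounded and w tends to 0.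
    √² : √ *ᴿ √ ≃ ℤ⇒ℝ (+ N)
    √² ε 0<ε =
        let M , p = bounded*null (√ +ᴿ √ +ᴿ fromℚ 1ℚ) {reciprocal} w→0 ε 0<ε
            M′ , w≤1 = reciprocal→0 1ℚ (ℚP.positive⁻¹ 1ℚ)
        in M ℕ.⊔ M′ , λ k K≤k →
          let w = reciprocal k
              0≤w = ℚP.<⇒≤ (reciprocal-pos k)
              0≤2x+1 : 0ℚ ℚ.≤ x k ℚ.+ x k ℚ.+ 1ℚ
              0≤2x+1 = ℚP.+-mono-≤ (ℚP.+-mono-≤ (0≤x k) (0≤x k)) (ℚP.nonNegative⁻¹ 1ℚ)
              0≤E = ≡.subst (ℚ._≤ (x k ℚ.+ x k ℚ.+ 1ℚ) ℚ.* w) (ℚP.*-zeroˡ w)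
                      (ℚP.*-monoʳ-≤-nonNeg w {{ℚ.nonNegative 0≤w}} 0≤2x+1)
              E≤ε = ≡.subst (ℚ._≤ ε) (ℚP.0≤p⇒∣p∣≡p 0≤E) (p k (ℕP.m⊔n≤o⇒m≤o M M′ K≤k))
          in ∣x-y∣≤ε
            (begin
              x k ℚ.* x k                              ≤⟨ x²≤q k ⟩
              q                                        ≡⟨ ℚP.+-identityʳ q ⟨
              q ℚ.+ 0ℚ                                 ≤⟨ ℚP.+-monoʳ-≤ q (ℚP.<⇒≤ 0<ε) ⟩
              q ℚ.+ ε                                  ∎)
            (begin
              q                                        ≤⟨ ℚP.<⇒≤ (q<[x+w]² k) ⟩
              (x k ℚ.+ w) ℚ.* (x k ℚ.+ w)
                ≡⟨ solve 2 (λ x w → (x :+ w) :* (x :+ w) := x :* x :+ (x :+ x :+ w) :* w) ≡.refl (x k) w ⟩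
              x k ℚ.* x k ℚ.+ (x k ℚ.+ x k ℚ.+ w) ℚ.* w
                ≤⟨ ℚP.+-monoʳ-≤ (x k ℚ.* x k) (ℚP.*-monoʳ-≤-nonNeg w {{ℚ.nonNegative 0≤w}}
                     (ℚP.+-monoʳ-≤ (x k ℚ.+ x k) (w≤1 k (ℕP.m⊔n≤o⇒n≤o M M′ K≤k)))) ⟩
              x k ℚ.* x k ℚ.+ (x k ℚ.+ x k ℚ.+ 1ℚ) ℚ.* w  ≤⟨ ℚP.+-monoʳ-≤ (x k ℚ.* x k) E≤ε ⟩
              x k ℚ.* x k ℚ.+ ε                        ∎)
      where
      open ℚP.≤-Reasoning
      w→0 : ∀ ε → 0ℚ ℚ.< ε → ∃ λ N → ∀ k → N ℕ.≤ k → ∣ reciprocal k ∣ ℚ.≤ ε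
      w→0 ε 0<ε =
        let N , w≤ε = reciprocal→0 ε 0<ε
        in N , λ k N≤k → ≡.subst (ℚ._≤ ε) (≡.sym (ℚP.0≤p⇒∣p∣≡p (ℚP.<⇒≤ (reciprocal-pos k)))) (w≤ε k N≤k)

open ≡ using (refl; cong; cong₂; sym; trans; subst)

-- From a point set to the minimum diameter

-- Strong induction: if there is no least element, then `P` fails at every number below `k`, which
-- makes `k` itself least.
least : ∀ {P : ℕ → Set} k → P k → ¬ ¬ ∃ λ δ → P δ × (∀ δ′ → P δ′ → δ ℕ.≤ δ′)
least {P} = <-rec _ λ k rec Pk none →
  none (k , Pk , λ δ′ Pδ′ → ℕP.≮⇒≥ λ δ′<k → rec δ′<k Pδ′ none)

attained⇒d≤ : ∀ {m n D} (P : IntegralPointSet m n) → diam P ℕ.≤ D → d⟨ m , n ⟩≤ D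
attained⇒d≤ P diam≤D = record
  { exists   = least (diam P) (P , refl)
  ; bounds   = λ δ δ-min → ℕP.≤-trans (proj₂ δ-min (diam P) (P , refl)) diam≤D
  ; attained = P , diam≤D
  }

diam≤ : ∀ {m n D} (P : IntegralPointSet m n) → (∀ i j → IntegralPointSet.distance P i j ℕ.≤ D) → diam P ℕ.≤ D
diam≤ {n = n} P d≤D = max≤v⁺ ℕ.z≤n
  (cartesianProductWith⁺ (≡.setoid _) (≡.setoid _) distance (allFin n) (allFin n) λ {i} {j} _ _ → d≤D i j)
  where open IntegralPointSet P

d-mono : ∀ {m n D D′} → D ℕ.≤ D′ → d⟨ m , n ⟩≤ D → d⟨ m , n ⟩≤ D′
d-mono D≤D′ d≤D = attained⇒d≤ (proj₁ attained) (ℕP.≤-trans (proj₂ attained) D≤D′)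
  where open d⟨_,_⟩≤_ d≤D

-- Points on a line and two simplices orthogonal to it

infix 8 _²
_² : ℤ → ℤ
z ² = z ℤ.* z

sq : ℕ → ℤ
sq d = (+ 2 ℤ.* + d) ²

-- Line points sit at the integers x i.  The simplices have their feet at F/2
-- and G/2, squared distance H/4 from the line and edge a; κ = ±1 is the sign
-- of the second one.  C/4 is the inner product of two distinct vertices, and
-- C ∈ ℕ encodes the existence condition a² ≤ 2D.  Corresponding vertices of
-- the two simplices are at distance p, the others at distance c.
record Configuration (K D : ℕ) : Set where
  field
    x     : Fin K → ℤ
    F G κ : ℤ
    a C   : ℕ
    r₁ r₂ : Fin K → ℕ
    p c   : ℕ

  2a² : ℕ
  2a² = 2 ℕ.* (a ℕ.* a)

  H : ℕ
  H = 2a² ℕ.+ C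

  InRange : ℕ → Set
  InRange d = 0 ℕ.< d × d ℕ.≤ D

  inRange? : ∀ d → Dec (InRange d)
  inRange? d = (0 ℕP.<? d) ×-dec (d ℕP.≤? D)

  field
    -- These conditions are implicit and decidable: for concrete data they evaluate to the unit type
    -- and are filled in automatically.
    {x-injective-true} : True (all? λ i → all? λ j → (x i ℤ.≟ x j) →-dec (i FinP.≟ j))
    {x-bounded-true}   : True (all? λ i → all? λ j → ℤ.∣ x i ℤ.- x j ∣ ℕP.≤? D)
    {κ²≡1-true}        : True (κ ℤ.* κ ℤ.≟ 1ℤ)
    {r₁-distance-true} : True (all? λ i → (+ 2 ℤ.* x i ℤ.- F) ² ℤ.+ + H ℤ.≟ sq (r₁ i))
    {r₂-distance-true} : True (all? λ i → (+ 2 ℤ.* x i ℤ.- G) ² ℤ.+ + H ℤ.≟ sq (r₂ i))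
    -- Doubled vertices have squared distance (F - G)² + H + H - 2κg, where the Gram entry g is H
    -- for corresponding vertices and C for the others.
    {p-distance-true}  : True ((F ℤ.- G) ² ℤ.+ + 2 ℤ.* (+ H ℤ.- κ ℤ.* + H) ℤ.≟ sq p)
    {c-distance-true}  : True ((F ℤ.- G) ² ℤ.+ + 2 ℤ.* (+ H ℤ.- κ ℤ.* + C) ℤ.≟ sq c)
    {r₁-range-true}    : True (all? λ i → inRange? (r₁ i))
    {r₂-range-true}    : True (all? λ i → inRange? (r₂ i))
    {a-range-true}     : True (inRange? a)
    {p-range-true}     : True (inRange? p)
    {c-range-true}     : True (inRange? c)

  x-injective = toWitness x-injective-true
  x-bounded   = toWitness x-bounded-true
  κ²≡1        = toWitness κ²≡1-true
  r₁-distance = toWitness r₁-distance-true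
  r₂-distance = toWitness r₂-distance-true
  p-distance  = toWitness p-distance-true
  c-distance  = toWitness c-distance-true
  r₁-range    = toWitness r₁-range-true
  r₂-range    = toWitness r₂-range-true
  a-range     = toWitness a-range-true
  p-range     = toWitness p-range-true
  c-range     = toWitness c-range-true

-- Realising a configuration in Euclidean space

module Realisation {K D : ℕ} (Γ : Configuration K D) (n′ : ℕ)
  {ℓ : ℕ} (2+ℓ≤K : 2 ℕ.+ ℓ ℕ.≤ K) where

  open Configuration Γ

  -- The number of vertices of each simplex, one less than the dimension of the space.
  n : ℕ
  n = suc n′

  open import Algebra.Properties.Semiring.Sum ℝR.semiring using (sum; sum-cong-≋; sum-replicate-zero)
  open Frame ℝ-commutativeRing ℤ⇒ℝ ℤ⇒ℝ-isRingHomomorphism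

  module √A = Sqrt 2a²
  module √S = Sqrt (2a² ℕ.+ n ℕ.* C)

  0<2a² : 0 ℕ.< 2a²
  0<2a² = ℕP.*-mono-≤ (ℕ.s≤s (ℕ.z≤n {1})) (ℕP.*-mono-≤ (proj₁ a-range) (proj₁ a-range))

  2a²+nC : + (2a² ℕ.+ n ℕ.* C) ≡ + 2a² ℤ.+ + n ℤ.* + C
  2a²+nC = cong (λ z → + 2a² ℤ.+ z) (ℤP.pos-* n C)

  S² : √S.√ *ᴿ √S.√ ≃ ℤ⇒ℝ (+ 2a² ℤ.+ + n ℤ.* + C)
  S² = subst (λ z → √S.√ *ᴿ √S.√ ≃ ℤ⇒ℝ z) 2a²+nC √S.√²

  1/n : ∃ λ r → fromℚ (ℤ⇒ℚ (+ n)) *ᴿ fromℚ r ≃ fromℚ ℚ.1ℚ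
  1/n = fromℚ-inverse (ℤ⇒ℚ (+ n)) (ℤ⇒ℚ-≢0 {+ n} λ ())

  ν : ℝ
  ν = fromℚ (proj₁ 1/n)

  nν : ν *ᴿ ℤ⇒ℝ (+ n) ≃ fromℚ ℚ.1ℚ
  nν = ≃-trans {ν *ᴿ ℤ⇒ℝ (+ n)} {ℤ⇒ℝ (+ n) *ᴿ ν} {fromℚ ℚ.1ℚ} (ℝR.*-comm ν (ℤ⇒ℝ (+ n))) (proj₂ 1/n)

  -- Here A² = 2a², so the edge √2·A of W is 2a, and halving the points makes it a.
  open Simplex {n} (+ 2a²) (+ C) √A.√ √S.√ ν √A.√² S² nν
  open Points (fromℚ ½) (≡⇒≃ {ℤ⇒ℝ (+ 2) *ᴿ fromℚ ½} {fromℚ ℚ.1ℚ} λ _ → refl) ℤ⇒ℝ-cancel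
    (λ 2a²≡0 → ℕP.<⇒≢ 0<2a² (sym (ℤP.+-injective 2a²≡0)))
    (λ S²≡0 → ℕP.<⇒≢ (ℕP.<-≤-trans 0<2a² (ℕP.m≤m+n 2a² (n ℕ.* C)))
      (sym (ℤP.+-injective (trans 2a²+nC S²≡0))))

  -- Squared distances as integers

  4d² : Label → Label → ℤ
  4d² P Q = (P ∙ P ℤ.+ Q ∙ Q) ℤ.- (P ∙ Q ℤ.+ P ∙ Q)

  ∙-comm : ∀ P Q → P ∙ Q ≡ Q ∙ P
  ∙-comm (X , s , i) (Y , t , j) = cong₂ ℤ._+_ (ℤP.*-comm X Y)
    (cong₂ (λ u d → u ℤ.* (+ 2a² ℤ.* d ℤ.+ + C)) (ℤP.*-comm s t) (δ-sym j i))
    where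
    δ-sym : ∀ {n} (i j : Fin n) → δ i j ≡ δ j i
    δ-sym zero    zero    = refl
    δ-sym zero    (suc j) = refl
    δ-sym (suc i) zero    = refl
    δ-sym (suc i) (suc j) = δ-sym i j

  4d²-comm : ∀ P Q → 4d² P Q ≡ 4d² Q P
  4d²-comm P Q = cong₂ ℤ._-_ (ℤP.+-comm (P ∙ P) (Q ∙ Q)) (cong₂ ℤ._+_ (∙-comm P Q) (∙-comm P Q))

  open ℤSolver.+-*-Solver using (solve; _:=_; _:+_; _:*_; _:-_; con)

  gram-≡ : ∀ (i : Fin n) → + 2a² ℤ.* δ i i ℤ.+ + C ≡ + H
  gram-≡ i = cong (ℤ._+ + C) (trans (cong (+ 2a² ℤ.*_) (δ-refl i)) (ℤP.*-identityʳ (+ 2a²)))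

  ∙-self : ∀ X s i → (X , s , i) ∙ (X , s , i) ≡ X ℤ.* X ℤ.+ s ℤ.* s ℤ.* + H
  ∙-self X s i = cong (λ g → X ℤ.* X ℤ.+ s ℤ.* s ℤ.* g) (gram-≡ i)

  4d²-line-line : ∀ X Y i → 4d² (X , 0ℤ , i) (Y , 0ℤ , i) ≡ (X ℤ.- Y) ²
  4d²-line-line X Y i = solve 3 (λ X Y g → let z = con 0ℤ :* g in
      ((X :* X :+ z) :+ (Y :* Y :+ z)) :- ((X :* Y :+ z) :+ (X :* Y :+ z)) := (X :- Y) :* (X :- Y))
    refl X Y (+ 2a² ℤ.* δ i i ℤ.+ + C)

  -- The Gram entry is a parameter `g`, so that equal and distinct vertices share one computation.
  4d²-formula : ∀ X Y s t i j g → + 2a² ℤ.* δ j i ℤ.+ + C ≡ g →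
    4d² (X , s , i) (Y , t , j)
      ≡ (X ℤ.- Y) ² ℤ.+ (s ℤ.* s ℤ.* + H ℤ.+ t ℤ.* t ℤ.* + H ℤ.- (s ℤ.* t ℤ.* g ℤ.+ s ℤ.* t ℤ.* g))
  4d²-formula X Y s t i j g refl = trans
    (cong₂ (λ u v → u ℤ.+ v ℤ.- ((X , s , i) ∙ (Y , t , j) ℤ.+ (X , s , i) ∙ (Y , t , j)))
      (∙-self X s i) (∙-self Y t j))
    (solve 5 (λ X Y u v w → (X :* X :+ u) :+ (Y :* Y :+ v) :- ((X :* Y :+ w) :+ (X :* Y :+ w))
                := (X :- Y) :* (X :- Y) :+ (u :+ v :- (w :+ w)))
       refl X Y (s ℤ.* s ℤ.* + H) (t ℤ.* t ℤ.* + H) (s ℤ.* t ℤ.* g))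

  gram-≢ : ∀ {i j : Fin n} → i ≢ j → + 2a² ℤ.* δ j i ℤ.+ + C ≡ + C
  gram-≢ i≢j = trans (cong (λ d → + 2a² ℤ.* d ℤ.+ + C) (δ-≢ (λ j≡i → i≢j (sym j≡i))))
    (trans (cong (ℤ._+ + C) (ℤP.*-zeroʳ (+ 2a²))) (ℤP.+-identityˡ (+ C)))

  -- Keeps the first 2 + ℓ line points, so that one configuration serves several cardinalities.
  ι : Fin (2 ℕ.+ ℓ) → Fin K
  ι i = inject≤ i 2+ℓ≤K

  -- The table of distances

  Index : Set
  Index = Fin (2 ℕ.+ ℓ) ⊎ (Fin n ⊎ Fin n)

  pattern line i  = inj₁ i
  pattern offF i  = inj₂ (inj₁ i)
  pattern offG i  = inj₂ (inj₂ i)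

  label : Index → Label
  -- The coefficient 0 removes the vertex, so `zero` is a mere default.
  label (line i) = + 2 ℤ.* x (ι i) , 0ℤ , zero
  label (offF i) = F , 1ℤ , i
  label (offG i) = G , κ , i

  dist : Index → Index → ℕ
  dist (line i) (line j) = ℤ.∣ x (ι i) ℤ.- x (ι j) ∣
  dist (line i) (offF j) = r₁ (ι i)
  dist (line i) (offG j) = r₂ (ι i)
  dist (offF i) (line j) = r₁ (ι j)
  dist (offG i) (line j) = r₂ (ι j)
  dist (offF i) (offF j) with i FinP.≟ j
  ... | yes _ = 0
  ... | no  _ = a
  dist (offG i) (offG j) with i FinP.≟ j
  ... | yes _ = 0
  ... | no  _ = a
  dist (offF i) (offG j) with i FinP.≟ j
  ... | yes _ = p
  ... | no  _ = c
  -- Tested in this order to mirror the preceding case, to which symmetry reduces it.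
  dist (offG i) (offF j) with j FinP.≟ i
  ... | yes _ = p
  ... | no  _ = c

  ∣z∣² : ∀ z → + ℤ.∣ z ∣ ℤ.* + ℤ.∣ z ∣ ≡ z ℤ.* z
  ∣z∣² (+ n)    = refl
  ∣z∣² -[1+ n ] = refl

  -- The feet agree and 2(H - C) = 4a².
  same-family : ∀ X s (s²≡1 : s ℤ.* s ≡ 1ℤ) i j → i ≢ j → 4d² (X , s , i) (X , s , j) ≡ sq a
  same-family X s s²≡1 i j i≢j = begin
    4d² (X , s , i) (X , s , j)
      ≡⟨ 4d²-formula X X s s i j (+ C) (gram-≢ i≢j) ⟩
    (X ℤ.- X) ² ℤ.+ (s ℤ.* s ℤ.* + H ℤ.+ s ℤ.* s ℤ.* + H ℤ.- (s ℤ.* s ℤ.* + C ℤ.+ s ℤ.* s ℤ.* + C))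
      ≡⟨ cong (λ u → (X ℤ.- X) ² ℤ.+ (u ℤ.* + H ℤ.+ u ℤ.* + H ℤ.- (u ℤ.* + C ℤ.+ u ℤ.* + C))) s²≡1 ⟩
    (X ℤ.- X) ² ℤ.+ (1ℤ ℤ.* + H ℤ.+ 1ℤ ℤ.* + H ℤ.- (1ℤ ℤ.* + C ℤ.+ 1ℤ ℤ.* + C))
      -- Rewrites the natural number 2a² as a product of integers, so that the solver can see `a`.
      ≡⟨ cong (λ h → (X ℤ.- X) ² ℤ.+
             (1ℤ ℤ.* (h ℤ.+ + C) ℤ.+ 1ℤ ℤ.* (h ℤ.+ + C) ℤ.- (1ℤ ℤ.* + C ℤ.+ 1ℤ ℤ.* + C)))
           (trans (ℤP.pos-* 2 (a ℕ.* a)) (cong (+ 2 ℤ.*_) (ℤP.pos-* a a))) ⟩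
    _ ≡⟨ solve 3 (λ X a C → let H = con (+ 2) :* (a :* a) :+ C in
            (X :- X) :* (X :- X) :+ (con 1ℤ :* H :+ con 1ℤ :* H :- (con 1ℤ :* C :+ con 1ℤ :* C))
              := (con (+ 2) :* a) :* (con (+ 2) :* a))
           refl X (+ a) (+ C) ⟩
    sq a ∎
    where open ≡.≡-Reasoning

  -- The mixed Gram term carries the factor 0: the simplex is orthogonal to the line, and Pythagoras
  -- gives the same distance for every vertex.
  line-off : ∀ X Y s (s²≡1 : s ℤ.* s ≡ 1ℤ) i j d → (X ℤ.- Y) ² ℤ.+ + H ≡ sq d →
             4d² (X , 0ℤ , i) (Y , s , j) ≡ sq d
  line-off X Y s s²≡1 i j d eq = begin
    4d² (X , 0ℤ , i) (Y , s , j)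
      ≡⟨ 4d²-formula X Y 0ℤ s i j _ refl ⟩
    _ ≡⟨ solve 3 (λ q h g → q :+ (con 0ℤ :+ h :- (con 0ℤ :* g :+ con 0ℤ :* g)) := q :+ h)
           refl ((X ℤ.- Y) ²) (s ℤ.* s ℤ.* + H) (+ 2a² ℤ.* δ j i ℤ.+ + C) ⟩
    (X ℤ.- Y) ² ℤ.+ s ℤ.* s ℤ.* + H
      ≡⟨ cong (λ h → (X ℤ.- Y) ² ℤ.+ h) (trans (cong (ℤ._* + H) s²≡1) (ℤP.*-identityˡ (+ H))) ⟩
    (X ℤ.- Y) ² ℤ.+ + H
      ≡⟨ eq ⟩
    sq d ∎
    where open ≡.≡-Reasoning

  cross : ∀ i j g d → + 2a² ℤ.* δ j i ℤ.+ + C ≡ g →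
          (F ℤ.- G) ² ℤ.+ + 2 ℤ.* (+ H ℤ.- κ ℤ.* g) ≡ sq d →
          4d² (F , 1ℤ , i) (G , κ , j) ≡ sq d
  cross i j g d g≡ eq = begin
    4d² (F , 1ℤ , i) (G , κ , j)
      ≡⟨ 4d²-formula F G 1ℤ κ i j g g≡ ⟩
    (F ℤ.- G) ² ℤ.+ (1ℤ ℤ.* 1ℤ ℤ.* + H ℤ.+ κ ℤ.* κ ℤ.* + H ℤ.- (1ℤ ℤ.* κ ℤ.* g ℤ.+ 1ℤ ℤ.* κ ℤ.* g))
      ≡⟨ cong (λ u → (F ℤ.- G) ² ℤ.+
             (1ℤ ℤ.* 1ℤ ℤ.* + H ℤ.+ u ℤ.* + H ℤ.- (1ℤ ℤ.* κ ℤ.* g ℤ.+ 1ℤ ℤ.* κ ℤ.* g))) κ²≡1 ⟩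
    (F ℤ.- G) ² ℤ.+ (1ℤ ℤ.* 1ℤ ℤ.* + H ℤ.+ 1ℤ ℤ.* + H ℤ.- (1ℤ ℤ.* κ ℤ.* g ℤ.+ 1ℤ ℤ.* κ ℤ.* g))
      ≡⟨ solve 4 (λ q h k g → q :+ (con 1ℤ :* con 1ℤ :* h :+ con 1ℤ :* h
                               :- (con 1ℤ :* k :* g :+ con 1ℤ :* k :* g))
                    := q :+ con (+ 2) :* (h :- k :* g))
           refl ((F ℤ.- G) ²) (+ H) κ g ⟩
    (F ℤ.- G) ² ℤ.+ + 2 ℤ.* (+ H ℤ.- κ ℤ.* g)
      ≡⟨ eq ⟩
    sq d ∎
    where open ≡.≡-Reasoning

  4d²-zero : ∀ P → 4d² P P ≡ sq 0
  4d²-zero P = ℤP.+-inverseʳ (P ∙ P ℤ.+ P ∙ P)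

  4d²-dist : ∀ u v → 4d² (label u) (label v) ≡ sq (dist u v)
  4d²-dist (line i) (line j) = trans (4d²-line-line (+ 2 ℤ.* x (ι i)) (+ 2 ℤ.* x (ι j)) zero)
    (begin
      (+ 2 ℤ.* X ℤ.- + 2 ℤ.* Y) ²
        ≡⟨ solve 2 (λ X Y → (con (+ 2) :* X :- con (+ 2) :* Y) :* (con (+ 2) :* X :- con (+ 2) :* Y)
                       := con (+ 4) :* ((X :- Y) :* (X :- Y))) refl X Y ⟩
      + 4 ℤ.* ((X ℤ.- Y) ²)
        ≡⟨ cong (+ 4 ℤ.*_) (sym (∣z∣² (X ℤ.- Y))) ⟩
      + 4 ℤ.* (d ℤ.* d)
        ≡⟨ solve 1 (λ d → con (+ 4) :* (d :* d) := (con (+ 2) :* d) :* (con (+ 2) :* d)) refl d ⟩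
      (+ 2 ℤ.* d) ℤ.* (+ 2 ℤ.* d) ∎)
    where
    open ≡.≡-Reasoning
    X = x (ι i)
    Y = x (ι j)
    d = + ℤ.∣ X ℤ.- Y ∣
  4d²-dist (line i) (offF j) = line-off (+ 2 ℤ.* x (ι i)) F 1ℤ refl zero j (r₁ (ι i)) (r₁-distance (ι i))
  4d²-dist (line i) (offG j) = line-off (+ 2 ℤ.* x (ι i)) G κ κ²≡1 zero j (r₂ (ι i)) (r₂-distance (ι i))
  4d²-dist (offF i) (line j) = trans (4d²-comm (label (offF i)) (label (line j))) (4d²-dist (line j) (offF i))
  4d²-dist (offG i) (line j) = trans (4d²-comm (label (offG i)) (label (line j))) (4d²-dist (line j) (offG i))
  4d²-dist (offF i) (offF j) with i FinP.≟ j
  ... | yes refl = 4d²-zero (label (offF i))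
  ... | no  i≢j  = same-family F 1ℤ refl i j i≢j
  4d²-dist (offG i) (offG j) with i FinP.≟ j
  ... | yes refl = 4d²-zero (label (offG i))
  ... | no  i≢j  = same-family G κ κ²≡1 i j i≢j
  4d²-dist (offF i) (offG j) with i FinP.≟ j
  ... | yes refl = cross i i (+ H) p (gram-≡ i) p-distance
  ... | no  i≢j  = cross i j (+ C) c (gram-≢ i≢j) c-distance
  4d²-dist (offG i) (offF j) with j FinP.≟ i
  ... | yes refl = trans (4d²-comm (label (offG i)) (label (offF i))) (cross i i (+ H) p (gram-≡ i) p-distance)
  ... | no  j≢i  = trans (4d²-comm (label (offG i)) (label (offF j))) (cross j i (+ C) c (gram-≢ j≢i) c-distance)

  dist≤D : ∀ u v → dist u v ℕ.≤ D
  dist≤D (line i) (line j) = x-bounded (ι i) (ι j)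
  dist≤D (line i) (offF j) = proj₂ (r₁-range (ι i))
  dist≤D (line i) (offG j) = proj₂ (r₂-range (ι i))
  dist≤D (offF i) (line j) = proj₂ (r₁-range (ι j))
  dist≤D (offG i) (line j) = proj₂ (r₂-range (ι j))
  dist≤D (offF i) (offF j) with i FinP.≟ j
  ... | yes _ = ℕ.z≤n
  ... | no  _ = proj₂ a-range
  dist≤D (offG i) (offG j) with i FinP.≟ j
  ... | yes _ = ℕ.z≤n
  ... | no  _ = proj₂ a-range
  dist≤D (offF i) (offG j) with i FinP.≟ j
  ... | yes _ = proj₂ p-range
  ... | no  _ = proj₂ c-range
  dist≤D (offG i) (offF j) with j FinP.≟ i
  ... | yes _ = proj₂ p-range
  ... | no  _ = proj₂ c-range

  pos≢0 : ∀ {k} {A : Set} → 0 ℕ.< k → k ≡ 0 → A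
  pos≢0 () refl

  dist≡0 : ∀ u v → dist u v ≡ 0 → u ≡ v
  dist≡0 (line i) (line j) eq = cong inj₁ (inject≤-injective 2+ℓ≤K 2+ℓ≤K i j
    (x-injective (ι i) (ι j) (ℤP.i-j≡0⇒i≡j (x (ι i)) (x (ι j)) (ℤP.∣i∣≡0⇒i≡0 eq))))
  dist≡0 (line i) (offF j) eq = pos≢0 (proj₁ (r₁-range (ι i))) eq
  dist≡0 (line i) (offG j) eq = pos≢0 (proj₁ (r₂-range (ι i))) eq
  dist≡0 (offF i) (line j) eq = pos≢0 (proj₁ (r₁-range (ι j))) eq
  dist≡0 (offG i) (line j) eq = pos≢0 (proj₁ (r₂-range (ι j))) eq
  dist≡0 (offF i) (offF j) eq with i FinP.≟ j
  ... | yes refl = refl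
  ... | no  _    = pos≢0 (proj₁ a-range) eq
  dist≡0 (offG i) (offG j) eq with i FinP.≟ j
  ... | yes refl = refl
  ... | no  _    = pos≢0 (proj₁ a-range) eq
  dist≡0 (offF i) (offG j) eq with i FinP.≟ j
  ... | yes _ = pos≢0 (proj₁ p-range) eq
  ... | no  _ = pos≢0 (proj₁ c-range) eq
  dist≡0 (offG i) (offF j) eq with j FinP.≟ i
  ... | yes _ = pos≢0 (proj₁ p-range) eq
  ... | no  _ = pos≢0 (proj₁ c-range) eq

  -- The integral point set

  Fin↔Index : Fin ((2 ℕ.+ ℓ) ℕ.+ (n ℕ.+ n)) ↔ Index
  Fin↔Index = (↔-id _ ⊎-↔ FinP.+↔⊎) ↔-∘ FinP.+↔⊎

  open Inverse Fin↔Index renaming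
    (to to index; from to position; strictlyInverseˡ to index-position; strictlyInverseʳ to position-index)
    using ()

  -- Coinciding points have integer distance 0, while the table has 0 only on its diagonal, by the
  -- positive lower ends of the ranges.
  ≈⇒≡ : ∀ u v → point (label u) ≈ point (label v) → u ≡ v
  ≈⇒≡ u v p≈q = dist≡0 u v (ℤP.+-injective (d≡0 (dist u v) (≃-trans {ℤ⇒ℝ d *ᴿ ℤ⇒ℝ d} {inner pq pq} {0ᴿ}
      (≃-sym {inner pq pq} {ℤ⇒ℝ d *ᴿ ℤ⇒ℝ d} (distance² (label u) (label v) d (4d²-dist u v)))
      inner≃0)))
    where
    d = + dist u v
    pq = point (label u) ⊖ point (label v)

    d≡0 : ∀ k → ℤ⇒ℝ (+ k) *ᴿ ℤ⇒ℝ (+ k) ≃ 0ᴿ → + k ≡ 0ℤ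
    d≡0 zero    _  = refl
    d≡0 (suc k) eq = ⊥-elim (ℤ⇒ℚ-≢0 {+ suc k} (λ ())
      (fromℚ-injective₀ {ℤ⇒ℚ (+ suc k)} (ℤ⇒ℝ-cancel (+ suc k) (λ ()) {ℤ⇒ℝ (+ suc k)} eq)))

    pq≃0 : ∀ k → pq k ≃ 0ᴿ
    pq≃0 k = ≃-trans {pq k} {point (label v) k -ᴿ point (label v) k} {0ᴿ}
      (+ᴿ-cong {point (label u) k} {point (label v) k} { -ᴿ point (label v) k} { -ᴿ point (label v) k}
        (p≈q k) (ℝR.refl { -ᴿ point (label v) k}))
      (ℝR.-‿inverseʳ (point (label v) k))

    inner≃0 : inner pq pq ≃ 0ᴿ
    inner≃0 = ≃-trans {inner pq pq} {sum {suc n} (λ _ → 0ᴿ)} {0ᴿ}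
      (sum-cong-≋ {suc n} {λ k → pq k *ᴿ pq k} {λ _ → 0ᴿ} λ k → ≃-trans {pq k *ᴿ pq k} {0ᴿ *ᴿ pq k} {0ᴿ}
        (*ᴿ-cong {pq k} {0ᴿ} {pq k} {pq k} (pq≃0 k) (ℝR.refl {pq k}))
        (ℝR.zeroˡ (pq k)))
      (sum-replicate-zero (suc n))

  pointSet : IntegralPointSet (suc n) ((2 ℕ.+ ℓ) ℕ.+ (n ℕ.+ n))
  pointSet = record
    { point    = λ i → point (label (index i))
    ; distinct = λ {i} {j} p≈q → trans (sym (position-index i))
        (trans (cong position (≈⇒≡ (index i) (index j) p≈q)) (position-index j))
    ; integral = λ i j → let u = index i ; v = index j in
        dist u v
        , (λ ε 0<ε → 0 , λ _ _ → ℚP.+-mono-≤ (0≤ℤ⇒ℚ (dist u v)) (ℚP.<⇒≤ 0<ε))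
        , ≃-sym {inner (point (label u) ⊖ point (label v)) (point (label u) ⊖ point (label v))}
                {ℤ⇒ℝ (+ dist u v) *ᴿ ℤ⇒ℝ (+ dist u v)}
            (distance² (label u) (label v) (+ dist u v) (4d²-dist u v))
    ; nonDegenerate = λ H all∈H →
        let open Hyperplane H
            on : ∀ u → inner normal (point (label u)) ≃ offset
            on u = subst (λ w → inner normal (point (label w)) ≃ offset) (index-position u) (all∈H (position u))
        -- The first two line points and the first simplex already span the space.
        in normal≉0 (spanning {+ 2 ℤ.* x (ι zero)} {+ 2 ℤ.* x (ι (suc zero))} {F} {zero}
             (λ 2x≡2y → 0≢1 (inject≤-injective 2+ℓ≤K 2+ℓ≤K zero (suc zero)
                (x-injective (ι zero) (ι (suc zero)) (ℤP.*-cancelˡ-≡ (+ 2) _ _ 2x≡2y))))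
             normal offset (on (line zero)) (on (line (suc zero))) (λ j → on (offF j)))
    }
    where
    0≢1 : zero ≢ suc {2 ℕ.+ ℓ ℕ.∸ 1} zero
    0≢1 ()

  d≤D : d⟨ suc n , (2 ℕ.+ ℓ) ℕ.+ (n ℕ.+ n) ⟩≤ D
  d≤D = attained⇒d≤ pointSet (diam≤ pointSet λ i j → dist≤D (index i) (index j))

-- Explicit configurations

parallelogram17 : Configuration 5 17
parallelogram17 = record
  { x  = lookup
      (+ 0 ∷ + 5 ∷ + 8 ∷ + 13 ∷ + 16 ∷ [])
  -- H = 315 = 5·63 = 7·45 = 9·35 = 15·21, so t² + 315 is a square for t = 29, 19, 13, 3; each x
  -- makes 2x - 13 and 2x - 29 such a t up to sign. The feet are 8 apart, and 6, 8, 10 is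
  -- Pythagorean.
  ; F = + 13 ; G = + 29 ; κ = 1ℤ
  ; a = 6 ; C = 243 ; p = 8 ; c = 10
  ; r₁ = lookup
      (11 ∷ 9 ∷ 9 ∷ 11 ∷ 13 ∷ [])
  ; r₂ = lookup
      (17 ∷ 13 ∷ 11 ∷ 9 ∷ 9 ∷ [])
  }

-- The extra point 21 completes the symmetry about 21/2, the midpoint of the two feet.
parallelogram21 : Configuration 6 21
parallelogram21 = record
  { x  = lookup
      (+ 0 ∷ + 5 ∷ + 8 ∷ + 13 ∷ + 16 ∷ + 21 ∷ [])
  ; F = + 13 ; G = + 29 ; κ = 1ℤ
  ; a = 6 ; C = 243 ; p = 8 ; c = 10
  ; r₁ = lookup
      (11 ∷ 9 ∷ 9 ∷ 11 ∷ 13 ∷ 17 ∷ [])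
  ; r₂ = lookup
      (17 ∷ 13 ∷ 11 ∷ 9 ∷ 9 ∷ 11 ∷ [])
  }

-- Since (u - v)² + 4uv = (u + v)², every factorisation uv = 900 gives x = u - v and r = u + v with
-- x² + 60² = r². The smaller factors 30, 25, 20, 18, 15, 12, 10 are used, and the line points span
-- 80 + 63 = 143.
rhombus143 : Configuration 12 143
rhombus143 = record
  { x  = lookup
      (+ 0 ∷ + 11 ∷ -[1+ 10 ] ∷ + 25 ∷ -[1+ 24 ] ∷ + 32 ∷ -[1+ 31 ] ∷ + 45 ∷ -[1+ 44 ] ∷ + 63 ∷
      -[1+ 62 ] ∷ + 80 ∷ [])
  ; F = + 0 ; G = + 0 ; κ = -1ℤ
  ; a = 72 ; C = 4032 ; p = 120 ; c = 96
  ; r₁ = r ; r₂ = r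
  }
  where
  r = lookup
      (60 ∷ 61 ∷ 61 ∷ 65 ∷ 65 ∷ 68 ∷ 68 ∷ 75 ∷ 75 ∷ 87 ∷ 87 ∷ 100 ∷ [])

-- The same with h = 120 and uv = 3600: the smaller factor runs through the divisors of 3600 from 60
-- down to 4, and the span is 896 + 715 = 1611.
rhombus1611 : Configuration 38 1611
rhombus1611 = record
  { x  = lookup
      (+ 0 ∷ + 22 ∷ -[1+ 21 ] ∷ + 27 ∷ -[1+ 26 ] ∷ + 35 ∷ -[1+ 34 ] ∷ + 50 ∷ -[1+ 49 ] ∷ + 64 ∷
      -[1+ 63 ] ∷ + 90 ∷ -[1+ 89 ] ∷ + 119 ∷ -[1+ 118 ] ∷ + 126 ∷ -[1+ 125 ] ∷ + 160 ∷
      -[1+ 159 ] ∷ + 182 ∷ -[1+ 181 ] ∷ + 209 ∷ -[1+ 208 ] ∷ + 225 ∷ -[1+ 224 ] ∷ + 288 ∷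
      -[1+ 287 ] ∷ + 350 ∷ -[1+ 349 ] ∷ + 391 ∷ -[1+ 390 ] ∷ + 442 ∷ -[1+ 441 ] ∷ + 594 ∷
      -[1+ 593 ] ∷ + 715 ∷ -[1+ 714 ] ∷ + 896 ∷ [])
  ; F = + 0 ; G = + 0 ; κ = -1ℤ
  ; a = 144 ; C = 16128 ; p = 240 ; c = 192
  ; r₁ = r ; r₂ = r
  }
  where
  r = lookup
      (120 ∷ 122 ∷ 122 ∷ 123 ∷ 123 ∷ 125 ∷ 125 ∷ 130 ∷ 130 ∷ 136 ∷ 136 ∷ 150 ∷ 150 ∷ 169 ∷ 169 ∷
      174 ∷ 174 ∷ 200 ∷ 200 ∷ 218 ∷ 218 ∷ 241 ∷ 241 ∷ 255 ∷ 255 ∷ 312 ∷ 312 ∷ 370 ∷ 370 ∷ 409 ∷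
      409 ∷ 458 ∷ 458 ∷ 606 ∷ 606 ∷ 725 ∷ 725 ∷ 904 ∷ [])

-- From configurations to the bounds

points-of : ∀ n {K D} → Configuration K D → ∀ k {D′} → {True (2 ℕ.+ k ℕP.≤? K)} → {True (D ℕP.≤? D′)} →
            d⟨ 2 ℕ.+ n , 2 ℕ.* (2 ℕ.+ n) ℕ.+ k ⟩≤ D′
points-of n Γ k {D′} {2+k≤K} {D≤D′} = subst (d⟨ 2 ℕ.+ n ,_⟩≤ D′) (count n k)
  (d-mono (toWitness D≤D′) (Realisation.d≤D Γ n (toWitness 2+k≤K)))
  where
  -- For m = 2 + n there are 2 + k line points and twice m - 1 vertices.
  count : ∀ n k → (2 ℕ.+ k) ℕ.+ ((1 ℕ.+ n) ℕ.+ (1 ℕ.+ n)) ≡ 2 ℕ.* (2 ℕ.+ n) ℕ.+ k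
  count = solve-∀

open import Data.Nat using (_+_; _*_; _≤_; s≤s)

mainTheorem3 : (m : ℕ) → 2 ≤ m →
    d⟨ m , 2 * m + 3 ⟩≤ 17
  × d⟨ m , 2 * m + 4 ⟩≤ 21
  × d⟨ m , 2 * m + 5 ⟩≤ 158
  × d⟨ m , 2 * m + 6 ⟩≤ 158
  × d⟨ m , 2 * m + 7 ⟩≤ 252
  × d⟨ m , 2 * m + 8 ⟩≤ 297
  × d⟨ m , 2 * m + 9 ⟩≤ 1073
  × d⟨ m , 2 * m + 10 ⟩≤ 1273
  × d⟨ m , 2 * m + 11 ⟩≤ 1888
  × d⟨ m , 2 * m + 12 ⟩≤ 2189
  × d⟨ m , 2 * m + 13 ⟩≤ 3224
  × d⟨ m , 2 * m + 14 ⟩≤ 3696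
  × d⟨ m , 2 * m + 15 ⟩≤ 5141
  × d⟨ m , 2 * m + 16 ⟩≤ 6586
  × d⟨ m , 2 * m + 17 ⟩≤ 11692
  × d⟨ m , 2 * m + 18 ⟩≤ 12296
  × d⟨ m , 2 * m + 19 ⟩≤ 16027
  × d⟨ m , 2 * m + 20 ⟩≤ 19758
  × d⟨ m , 2 * m + 21 ⟩≤ 32054
  × d⟨ m , 2 * m + 22 ⟩≤ 39516
  × d⟨ m , 2 * m + 23 ⟩≤ 254364
  × d⟨ m , 2 * m + 24 ⟩≤ 276612
  × d⟨ m , 2 * m + 25 ⟩≤ 338169
  × d⟨ m , 2 * m + 26 ⟩≤ 399726
  × d⟨ m , 2 * m + 27 ⟩≤ 1614202
  × d⟨ m , 2 * m + 28 ⟩≤ 1725442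
  × d⟨ m , 2 * m + 29 ⟩≤ 2033227
  × d⟨ m , 2 * m + 30 ⟩≤ 2067824
  × d⟨ m , 2 * m + 31 ⟩≤ 8132908
  × d⟨ m , 2 * m + 32 ⟩≤ 8271296
  × d⟨ m , 2 * m + 33 ⟩≤ 26431951
  × d⟨ m , 2 * m + 34 ⟩≤ 26881712
  × d⟨ m , 2 * m + 35 ⟩≤ 105727804
  × d⟨ m , 2 * m + 36 ⟩≤ 107526848
mainTheorem3 (suc (suc n)) (s≤s (s≤s _)) =
    points-of n parallelogram17 3
  , points-of n parallelogram21 4
  -- The full diameter 143 is below 158, the smallest bound for k from 5 to 10.
  , points-of n rhombus143 5
  , points-of n rhombus143 6
  , points-of n rhombus143 7
  , points-of n rhombus143 8
  , points-of n rhombus143 9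
  , points-of n rhombus143 10
  -- Likewise 1611 is below 1888, the smallest of the remaining bounds, and 38 line points reach k =
  -- 36.
  , points-of n rhombus1611 11
  , points-of n rhombus1611 12
  , points-of n rhombus1611 13
  , points-of n rhombus1611 14
  , points-of n rhombus1611 15
  , points-of n rhombus1611 16
  , points-of n rhombus1611 17
  , points-of n rhombus1611 18
  , points-of n rhombus1611 19
  , points-of n rhombus1611 20
  , points-of n rhombus1611 21
  , points-of n rhombus1611 22
  , points-of n rhombus1611 23
  , points-of n rhombus1611 24
  , points-of n rhombus1611 25
  , points-of n rhombus1611 26
  , points-of n rhombus1611 27
  , points-of n rhombus1611 28
  , points-of n rhombus1611 29
  , points-of n rhombus1611 30
  , points-of n rhombus1611 31
  , points-of n rhombus1611 32
  , points-of n rhombus1611 33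
  , points-of n rhombus1611 34
  , points-of n rhombus1611 35
  , points-of n rhombus1611 36
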